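{- Let $a,u,v,q$ be complex parameters (generic, so that no denominator vanishes). Let $K_0(n):=K(a,q^{ -n},q^{1-n},q^{2-n},a,u,v,q^3)$ and $K_0'(n):=K(aq,q^{ -n},q^{1-n},q^{2-n},aq,u,v,q^3)$, and put \[ A_r:=\frac{(aq,q^3u,q^3v,aq^4/u,aq^4/v;q^3)_r}{(u,v,aq/u,aq/v,q^3;q^3)_r}. \] (i) The sequences with $\alpha_0=\beta_0=1$, $\alpha_{3r+1}=\alpha_{3r+2}=0$ ($r\ge0$), \[ \alpha_{3r}=\frac{1-aq^{6r}}{1-a}\,\frac{(a,q^3u,q^3v,aq^3/u,aq^3/v;q^3)_r}{(u,v,a/u,a/v,q^3;q^3)_r}\,q^{\frac{9r^2-15r}{2}}(-a)^r,\qquad \beta_n=K_0(n)\frac{(a;q^3)_n}{(a;q)_{2n}(q;q)_n}, \] form a Bailey pair relative to $a$. (ii) The sequences with $\alpha_0=\beta_0=1$, $\alpha_{3r-1}=0$ ($r\ge1$), and for $r\ge0$ \[ \alpha_{3r}=A_r\,q^{\frac{9r^2-13r}{2}}(-a)^r,\quad \alpha_{3r+1}=A_r\,q^{\frac{9r^2-r}{2}+1}(-a)^{r+1},\quad \beta_n=K_0'(n)\frac{(aq;q^3)_n}{(aq;q)_{2n}(q;q)_n}, \] form a Bailey pair relative to $a$. (iii) The sequences with $\alpha_0=\beta_0=1$, $\alpha_{3r-1}=0$ ($r\ge1$), and for $r\ge0$ \[ \alpha_{3r}=A_r\,q^{\frac{9r^2-7r}{2}}(-a)^r,\quad \alpha_{3r+1}=-A_r\,q^{\frac{9r^2-7r}{2}}(-a)^{r},\quad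 \beta_n=K_0'(n)\frac{(aq;q^3)_n\,q^n}{(aq;q)_{2n}(q;q)_n}, \] form a Bailey pair relative to $a$.
   Context: Notation: $(x;q)_n=\prod_{k=0}^{n-1}(1-xq^k)$ and $(x_1,\dots,x_k;q)_n=(x_1;q)_n\cdots(x_k;q)_n$. A pair of sequences $(\alpha_n)_{n\ge0},(\beta_n)_{n\ge0}$ is a Bailey pair relative to $a$ if $\alpha_0=1$ and $\beta_n=\sum_{j=0}^{n}\frac{\alpha_j}{(q;q)_{n-j}(aq;q)_{n+j}}$ for all $n\ge0$. The function $K$: for complex $a,b,c,d,e,u,v$ and a base $p$, let $\sigma_1,\dots,\sigma_4$ be the elementary symmetric functions of $b,c,d,e$ and \[ K(a,b,c,d,e,u,v,p):=\frac{uv(\sigma_3-a\sigma_1)(p\sigma_3-a\sigma_1)a^2+(1-p)uv(a^2-\sigma_4)(a^2-\sigma_2a+\sigma_4)a+(u+v)(a+uv)(\sigma_3-a\sigma_1)(a^2-p\sigma_4)a+(u^2+a)(v^2+a)(a^2-\sigma_4)(a^2-p\sigma_4)}{(a^2-bcde)(a^2-bcde\,p)(1-u)(a-u)(1-v)(a-v)}. \] -}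

module Defs where

open import Level using (Level; _⊔_) renaming (suc to lsuc)
open import Algebra.Bundles using (CommutativeRing)
open import Relation.Nullary using (¬_)
open import Data.Product using (_×_)
open import Data.Nat as ℕ using (ℕ; zero; suc; _∸_)
import Data.Integer as ℤ
open ℤ using (ℤ; +_; -[1+_])

ringFromℕ : ∀ {c ℓ} (R : CommutativeRing c ℓ) → ℕ → CommutativeRing.Carrier R
ringFromℕ R zero    = CommutativeRing.0# R
ringFromℕ R (suc n) = CommutativeRing._+_ R (CommutativeRing.1# R) (ringFromℕ R n)

-- A field, presented as a commutative ring together with a *total*
-- operation _⁻¹ which is a multiplicative inverse on every nonzero
-- element (its value at 0 is irrelevant: it is only ever applied to
-- quantities assumed nonzero), with 0 ≠ 1, and of characteristic zero
-- (as is ℂ, the field of the paper).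
record Field (c ℓ : Level) : Set (lsuc (c ⊔ ℓ)) where
  field
    commutativeRing : CommutativeRing c ℓ
  open CommutativeRing commutativeRing public
  field
    _⁻¹        : Carrier → Carrier
    ⁻¹-cong    : ∀ {x y} → x ≈ y → x ⁻¹ ≈ y ⁻¹
    ⁻¹-inverse : ∀ x → ¬ (x ≈ 0#) → x * (x ⁻¹) ≈ 1#
    0≉1        : ¬ (0# ≈ 1#)

  field
    charZero : ∀ n → ¬ (ringFromℕ commutativeRing (suc n) ≈ 0#)

module FieldDefs {c ℓ : Level} (F : Field c ℓ) where
  open Field F hiding (zero)

  infixl 7 _÷_
  _÷_ : Carrier → Carrier → Carrier
  x ÷ y = x * (y ⁻¹)

  pow : Carrier → ℕ → Carrier
  pow x zero    = 1#
  pow x (suc n) = x * pow x n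

  zpow : Carrier → ℤ → Carrier
  zpow x (+ n)     = pow x n
  zpow x -[1+ n ]  = pow (x ⁻¹) (suc n)

  poch : Carrier → Carrier → ℕ → Carrier
  poch x q zero    = 1#
  poch x q (suc n) = poch x q n * (1# - x * pow q n)

  sumTo : (ℕ → Carrier) → ℕ → Carrier
  sumTo f zero    = f zero
  sumTo f (suc n) = sumTo f n + f (suc n)

  BaileyPair : (a q : Carrier) → (α β : ℕ → Carrier) → Set ℓ
  BaileyPair a q α β =
    (α 0 ≈ 1#) × (∀ n → β n ≈ sumTo (λ j → α j ÷ (poch q q (n ∸ j) * poch (a * q) q (n ℕ.+ j))) n)

  module _ (a b c′ d e u v p : Carrier) where
    private
      σ₁ = b + c′ + d + e
      σ₂ = b * c′ + b * d + b * e + c′ * d + c′ * e + d * e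
      σ₃ = b * c′ * d + b * c′ * e + b * d * e + c′ * d * e
      σ₄ = b * c′ * d * e
      a² = a * a

    Knum : Carrier
    Knum =
        u * v * (σ₃ - a * σ₁) * (p * σ₃ - a * σ₁) * a²
      + (1# - p) * u * v * (a² - σ₄) * (a² - σ₂ * a + σ₄) * a
      + (u + v) * (a + u * v) * (σ₃ - a * σ₁) * (a² - p * σ₄) * a
      + (u * u + a) * (v * v + a) * (a² - σ₄) * (a² - p * σ₄)

    Kden : Carrier
    Kden = (a² - b * c′ * d * e) * (a² - b * c′ * d * e * p)
           * (1# - u) * (a - u) * (1# - v) * (a - v)

  K : (a b c′ d e u v p : Carrier) → Carrier
  K a b c′ d e u v p = Knum a b c′ d e u v p ÷ Kden a b c′ d e u v p

  module _ (a u v q : Carrier) where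
    q³ : Carrier
    q³ = pow q 3

    zq : ℤ → Carrier
    zq = zpow q

    K₀ : ℕ → Carrier
    K₀ n = K a (zq (ℤ.- (+ n))) (zq (+ 1 ℤ.- + n)) (zq (+ 2 ℤ.- + n)) a u v q³

    K₀′ : ℕ → Carrier
    K₀′ n = K (a * q) (zq (ℤ.- (+ n))) (zq (+ 1 ℤ.- + n)) (zq (+ 2 ℤ.- + n)) (a * q) u v q³

    K₀-den : ℕ → Carrier
    K₀-den n = Kden a (zq (ℤ.- (+ n))) (zq (+ 1 ℤ.- + n)) (zq (+ 2 ℤ.- + n)) a u v q³

    K₀′-den : ℕ → Carrier
    K₀′-den n = Kden (a * q) (zq (ℤ.- (+ n))) (zq (+ 1 ℤ.- + n)) (zq (+ 2 ℤ.- + n)) (a * q) u v q³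

    -- exponent (9 r^2 + k r)/2 + m, computed in ℤ (the numerator is always even)
    ex : ℤ → ℕ → ℤ
    ex k r = (+ (9 ℕ.* r ℕ.* r) ℤ.+ k ℤ.* + r) ℤ./ℕ 2

    A : ℕ → Carrier
    A r = (poch (a * q) q³ r * poch (q³ * u) q³ r * poch (q³ * v) q³ r
           * poch (a * pow q 4 ÷ u) q³ r * poch (a * pow q 4 ÷ v) q³ r)
        ÷ (poch u q³ r * poch v q³ r * poch (a * q ÷ u) q³ r
           * poch (a * q ÷ v) q³ r * poch q³ q³ r)

    α₁-3r : ℕ → Carrier
    α₁-3r r = ((1# - a * pow q (6 ℕ.* r)) ÷ (1# - a))
      * ((poch a q³ r * poch (q³ * u) q³ r * poch (q³ * v) q³ r
          * poch (a * q³ ÷ u) q³ r * poch (a * q³ ÷ v) q³ r)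
         ÷ (poch u q³ r * poch v q³ r * poch (a ÷ u) q³ r
            * poch (a ÷ v) q³ r * poch q³ q³ r))
      * zq (ex (ℤ.- (+ 15)) r) * pow (- a) r

    sel₁ : ℕ → ℕ → Carrier
    sel₁ zero r = α₁-3r r
    sel₁ (suc _) r = 0#

    α₁ : ℕ → Carrier
    α₁ zero = 1#
    α₁ n@(suc _) = sel₁ (n ℕ.% 3) (n ℕ./ 3)

    β₁ : ℕ → Carrier
    β₁ zero = 1#
    β₁ n@(suc _) = K₀ n * (poch a q³ n ÷ (poch a q (2 ℕ.* n) * poch q q n))

    sel₂ : ℕ → ℕ → Carrier
    sel₂ zero r = A r * zq (ex (ℤ.- (+ 13)) r) * pow (- a) r
    sel₂ (suc zero) r = A r * zq (ex (ℤ.- (+ 1)) r ℤ.+ + 1) * pow (- a) (suc r)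
    sel₂ (suc (suc _)) r = 0#

    α₂ : ℕ → Carrier
    α₂ zero = 1#
    α₂ n@(suc _) = sel₂ (n ℕ.% 3) (n ℕ./ 3)

    β₂ : ℕ → Carrier
    β₂ zero = 1#
    β₂ n@(suc _) = K₀′ n * (poch (a * q) q³ n ÷ (poch (a * q) q (2 ℕ.* n) * poch q q n))

    sel₃ : ℕ → ℕ → Carrier
    sel₃ zero r = A r * zq (ex (ℤ.- (+ 7)) r) * pow (- a) r
    sel₃ (suc zero) r = - (A r * zq (ex (ℤ.- (+ 7)) r) * pow (- a) r)
    sel₃ (suc (suc _)) r = 0#

    α₃ : ℕ → Carrier
    α₃ zero = 1#
    α₃ n@(suc _) = sel₃ (n ℕ.% 3) (n ℕ./ 3)

    β₃ : ℕ → Carrier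
    β₃ zero = 1#
    β₃ n@(suc _) = K₀′ n * (poch (a * q) q³ n * pow q n ÷ (poch (a * q) q (2 ℕ.* n) * poch q q n))

    record Generic : Set ℓ where
      field
        q≉0 : ¬ (q ≈ 0#)
        u≉0 : ¬ (u ≈ 0#)
        v≉0 : ¬ (v ≈ 0#)
        1-a≉0 : ¬ ((1# - a) ≈ 0#)
        qq≉0  : ∀ m → ¬ (poch q q m ≈ 0#)
        aq≉0  : ∀ m → ¬ (poch a q m ≈ 0#)
        aqq≉0 : ∀ m → ¬ (poch (a * q) q m ≈ 0#)
        u3≉0  : ∀ m → ¬ (poch u q³ m ≈ 0#)
        v3≉0  : ∀ m → ¬ (poch v q³ m ≈ 0#)
        au3≉0 : ∀ m → ¬ (poch (a ÷ u) q³ m ≈ 0#)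
        av3≉0 : ∀ m → ¬ (poch (a ÷ v) q³ m ≈ 0#)
        aqu3≉0 : ∀ m → ¬ (poch (a * q ÷ u) q³ m ≈ 0#)
        aqv3≉0 : ∀ m → ¬ (poch (a * q ÷ v) q³ m ≈ 0#)
        q33≉0 : ∀ m → ¬ (poch q³ q³ m ≈ 0#)
        K₀den≉0  : ∀ n → ¬ (K₀-den n ≈ 0#)
        K₀′den≉0 : ∀ n → ¬ (K₀′-den n ≈ 0#)

{-# OPTIONS --safe #-}
-- Write p = q³, z = q^{3r}, x_r = 1/z + a z. The factor (1 − u z)(1 − a z/u)/z equals x_r − (u + a/u), so
-- in (i) α_{3r} is the classical sequence (1 − a z²) (a;p)_r/(p;p)_r (−a)^r q^{(9r²−3r)/2} weighted by a
-- quadratic polynomial in x_r. The unweighted sum b_n is evaluated by a WZ certificate. As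
-- (1 − q^{n−j})(1 − a q^{n+j}) = 1 + a q^{2n} − q^n (q^{−j} + a q^j), weighting by x_r turns b_n into
-- q^{−n}((1 + a q^{2n}) b_n − b_{n−1}), and doing so twice expresses the weighted sum through b_n, b_{n−1},
-- b_{n−2}; this is what K records. In (ii) and (iii) the terms j = 3r and j = 3r+1 add up to a term of (i)
-- with aq in place of a.

module Submission where

open import Defs
open import Data.Product using (_×_; _,_)
open import Algebra.Bundles using (CommutativeRing)
import Algebra.Solver.Ring
open import Algebra.Solver.Ring.AlmostCommutativeRing
  using (fromCommutativeRing; _-Raw-AlmostCommutative⟶_)
open import Data.Fin using (zero; suc; #_)
import Data.Integer as ℤ
import Data.Integer.Properties as ℤ
import Data.Integer.Tactic.RingSolver as ℤ-Solver
open import Data.Maybe.Base using (Maybe; just; nothing)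
open import Data.Nat as ℕ using (ℕ; zero; suc; _∸_; _≤_; _<_; z≤n; s≤s)
open import Data.Nat.Divisibility using (divides)
import Data.Nat.DivMod as ℕ
import Data.Nat.Properties as ℕ
import Data.Nat.Tactic.RingSolver as ℕ-Solver
open import Data.Vec using (Vec; _∷_; []; lookup)
open import Relation.Nullary using (¬_; yes; no)
open import Relation.Binary.PropositionalEquality as ≡ using (_≡_)

-- In base p the symbol (q⁻ⁿ;q)_(3r) splits into (q⁻ⁿ, q¹⁻ⁿ, q²⁻ⁿ;p)_r, so b_n is, up to a factor
-- depending only on n, a terminating very-well-poised 6φ5 series in base p. This is why it has a
-- closed form with a first-order recurrence in n, why these three powers of q are arguments of K,
-- and why the exponent is (9r² - 3r)/2, the binomial coefficient 3r over 2. The obstacle is to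
-- verify rational identities over an abstract field by ring normalisation. Each inverse (of z, u,
-- v, qⁿ) is therefore a letter of its own, and an identity is checked as a polynomial one plus
-- explicit multiples of relations such as z · z⁻ = 1. Recurrences are stated with their
-- denominators cleared, and nonzero factors are cancelled only at the end. The reciprocal of
-- (q;q)_(n-j) is continued by 0 beyond j = n, so that its recurrences need no case distinction and
-- neighbouring values of n can share one range of summation.

module IntegerSolver {c ℓ} (R : CommutativeRing c ℓ) where
  open CommutativeRing R
  open import Algebra.Properties.Ring ring
  open import Algebra.Properties.Semiring.Mult.TCOptimised semiring renaming (_×_ to _·_)
  open import Algebra.Properties.Semiring.Exp semiring using (^-congˡ)
  open import Relation.Binary.Reasoning.Setoid setoid

  ⟦_⟧ℤ : ℤ.ℤ → Carrier
  ⟦ ℤ.+ n ⟧ℤ      = n · 1#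
  ⟦ ℤ.-[1+ n ] ⟧ℤ = - (ℕ.suc n · 1#)

  ⊖-homo : ∀ m n → ⟦ m ℤ.⊖ n ⟧ℤ ≈ m · 1# - n · 1#
  ⊖-homo m ℕ.zero = sym (trans (+-congˡ -0#≈0#) (+-identityʳ _))
  ⊖-homo ℕ.zero (ℕ.suc n) = sym (+-identityˡ _)
  ⊖-homo (ℕ.suc m) (ℕ.suc n) = begin
    ⟦ ℕ.suc m ℤ.⊖ ℕ.suc n ⟧ℤ            ≡⟨ ≡.cong ⟦_⟧ℤ (ℤ.[1+m]⊖[1+n]≡m⊖n m n) ⟩
    ⟦ m ℤ.⊖ n ⟧ℤ                        ≈⟨ ⊖-homo m n ⟩
    m · 1# - n · 1#                     ≈⟨ +-congʳ (+-identityˡ _) ⟨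
    (0# + m · 1#) - n · 1#              ≈⟨ +-congʳ (+-congʳ (-‿inverseʳ 1#)) ⟨
    (1# - 1# + m · 1#) - n · 1#         ≈⟨ +-congʳ (trans (+-assoc _ _ _) (trans (+-congˡ (+-comm _ _)) (sym (+-assoc _ _ _)))) ⟩
    (1# + m · 1# - 1#) - n · 1#         ≈⟨ +-assoc _ _ _ ⟩
    1# + m · 1# + (- 1# - n · 1#)       ≈⟨ +-congˡ (-‿+-comm 1# (n · 1#)) ⟩
    1# + m · 1# - (1# + n · 1#)         ≈⟨ +-cong (1+× m 1#) (-‿cong (1+× n 1#)) ⟨
    ℕ.suc m · 1# - ℕ.suc n · 1#         ∎

  -‿homoℤ : ∀ i → ⟦ ℤ.- i ⟧ℤ ≈ - ⟦ i ⟧ℤ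
  -‿homoℤ (ℤ.+ ℕ.zero)  = sym -0#≈0#
  -‿homoℤ ℤ.+[1+ n ]    = refl
  -‿homoℤ ℤ.-[1+ n ]    = sym (-‿involutive _)

  +-homoℤ : ∀ i j → ⟦ i ℤ.+ j ⟧ℤ ≈ ⟦ i ⟧ℤ + ⟦ j ⟧ℤ
  +-homoℤ (ℤ.+ m) (ℤ.+ n) = ×-homo-+ 1# m n
  +-homoℤ (ℤ.+ m) ℤ.-[1+ n ] = ⊖-homo m (ℕ.suc n)
  +-homoℤ ℤ.-[1+ m ] (ℤ.+ n) = trans (⊖-homo n (ℕ.suc m)) (+-comm _ _)
  +-homoℤ i@(ℤ.-[1+ m ]) j@(ℤ.-[1+ n ]) = begin
    ⟦ i ℤ.+ j ⟧ℤ                             ≡⟨ ≡.cong ⟦_⟧ℤ (ℤ.neg-distrib-+ (ℤ.+ ℕ.suc m) (ℤ.+ ℕ.suc n)) ⟨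
    ⟦ ℤ.- (ℤ.+ (ℕ.suc m ℕ.+ ℕ.suc n)) ⟧ℤ     ≈⟨ -‿cong (×-homo-+ 1# (ℕ.suc m) (ℕ.suc n)) ⟩
    - (ℕ.suc m · 1# + ℕ.suc n · 1#)          ≈⟨ -‿+-comm _ _ ⟨
    ⟦ i ⟧ℤ + ⟦ j ⟧ℤ                          ∎

  *-homo⁺ : ∀ m n → ⟦ ℤ.+ m ℤ.* ℤ.+ n ⟧ℤ ≈ ⟦ ℤ.+ m ⟧ℤ * ⟦ ℤ.+ n ⟧ℤ
  *-homo⁺ m n = trans (reflexive (≡.cong ⟦_⟧ℤ (≡.sym (ℤ.pos-* m n)))) (×1-homo-* m n)

  *-homo⁻ : ∀ i n → ⟦ i ℤ.* ℤ.+ n ⟧ℤ ≈ ⟦ i ⟧ℤ * ⟦ ℤ.+ n ⟧ℤ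
  *-homo⁻ (ℤ.+ m) n = *-homo⁺ m n
  *-homo⁻ i@(ℤ.-[1+ m ]) n = begin
    ⟦ i ℤ.* ℤ.+ n ⟧ℤ                    ≡⟨ ≡.cong ⟦_⟧ℤ (ℤ.neg-distribˡ-* (ℤ.+ ℕ.suc m) (ℤ.+ n)) ⟨
    ⟦ ℤ.- (ℤ.+ ℕ.suc m ℤ.* ℤ.+ n) ⟧ℤ    ≈⟨ -‿homoℤ (ℤ.+ ℕ.suc m ℤ.* ℤ.+ n) ⟩
    - ⟦ ℤ.+ ℕ.suc m ℤ.* ℤ.+ n ⟧ℤ        ≈⟨ -‿cong (*-homo⁺ (ℕ.suc m) n) ⟩
    - (ℕ.suc m · 1# * (n · 1#))         ≈⟨ -‿distribˡ-* _ _ ⟩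
    ⟦ i ⟧ℤ * ⟦ ℤ.+ n ⟧ℤ                 ∎

  *-homoℤ : ∀ i j → ⟦ i ℤ.* j ⟧ℤ ≈ ⟦ i ⟧ℤ * ⟦ j ⟧ℤ
  *-homoℤ i (ℤ.+ n) = *-homo⁻ i n
  *-homoℤ i j@(ℤ.-[1+ n ]) = begin
    ⟦ i ℤ.* j ⟧ℤ                        ≡⟨ ≡.cong ⟦_⟧ℤ (ℤ.neg-distribʳ-* i (ℤ.+ ℕ.suc n)) ⟨
    ⟦ ℤ.- (i ℤ.* ℤ.+ ℕ.suc n) ⟧ℤ        ≈⟨ -‿homoℤ (i ℤ.* ℤ.+ ℕ.suc n) ⟩
    - ⟦ i ℤ.* ℤ.+ ℕ.suc n ⟧ℤ            ≈⟨ -‿cong (*-homo⁻ i (ℕ.suc n)) ⟩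
    - (⟦ i ⟧ℤ * (ℕ.suc n · 1#))         ≈⟨ -‿distribʳ-* _ _ ⟩
    ⟦ i ⟧ℤ * ⟦ j ⟧ℤ                     ∎

  -- Coefficients are taken in ℤ because its equality is decidable, which that of the field need not
  -- be; without it the solver could not recognise cancelling numerals.
  ℤ⟶R : ℤ.+-*-rawRing -Raw-AlmostCommutative⟶ fromCommutativeRing R
  ℤ⟶R = record
    { ⟦_⟧ = ⟦_⟧ℤ ; +-homo = +-homoℤ ; *-homo = *-homoℤ ; -‿homo = -‿homoℤ
    ; 0-homo = refl ; 1-homo = refl }

  _≟ℤ_ : ∀ i j → Maybe (⟦ i ⟧ℤ ≈ ⟦ j ⟧ℤ)
  i ≟ℤ j with i ℤ.≟ j
  ... | yes i≡j = just (reflexive (≡.cong ⟦_⟧ℤ i≡j))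
  ... | no  _   = nothing

  open Algebra.Solver.Ring ℤ.+-*-rawRing (fromCommutativeRing R) ℤ⟶R _≟ℤ_ public

  :1 : ∀ {n} → Polynomial n
  :1 = con (ℤ.+ 1)

  :0 : ∀ {n} → Polynomial n
  :0 = con (ℤ.+ 0)

  -- Lets arguments be replaced inside the long expressions for K by one induction on syntax,
  -- instead of a congruence for every occurrence.
  ⟦⟧-cong : ∀ {n} (e : Polynomial n) {ρ ρ′ : Vec Carrier n} →
            (∀ i → lookup ρ i ≈ lookup ρ′ i) → ⟦ e ⟧ ρ ≈ ⟦ e ⟧ ρ′
  ⟦⟧-cong (op [+] e₁ e₂) ρ≈ρ′ = +-cong (⟦⟧-cong e₁ ρ≈ρ′) (⟦⟧-cong e₂ ρ≈ρ′)
  ⟦⟧-cong (op [*] e₁ e₂) ρ≈ρ′ = *-cong (⟦⟧-cong e₁ ρ≈ρ′) (⟦⟧-cong e₂ ρ≈ρ′)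
  ⟦⟧-cong (con _)        ρ≈ρ′ = refl
  ⟦⟧-cong (var i)        ρ≈ρ′ = ρ≈ρ′ i
  ⟦⟧-cong (e :^ k)       ρ≈ρ′ = ^-congˡ k (⟦⟧-cong e ρ≈ρ′)
  ⟦⟧-cong (:- e)         ρ≈ρ′ = -‿cong (⟦⟧-cong e ρ≈ρ′)

-- Halving the integer exponents of q

/ℕ-exact : ∀ i → (i ℤ.* ℤ.+ 2) ℤ./ℕ 2 ≡ i
/ℕ-exact (ℤ.+ n) = ≡.trans (≡.cong (ℤ._/ℕ 2) (≡.sym (ℤ.pos-* n 2))) (≡.cong ℤ.+_ (ℕ.m*n/n≡m n 2))
/ℕ-exact ℤ.-[1+ n ] rewrite ℕ.m*n%n≡0 (suc n) 2 {{_}} | ℕ.m*n/n≡m (suc n) 2 {{_}} = ≡.refl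

-- T r = (9r² − 3r)/2
T : ℕ → ℕ
T zero    = 0
T (suc r) = r ℕ.* 3 ℕ.+ (r ℕ.* 3 ℕ.+ (r ℕ.* 3 ℕ.+ (3 ℕ.+ T r)))

T-closed : ∀ r → T r ℕ.* 2 ℕ.+ 3 ℕ.* r ≡ 9 ℕ.* r ℕ.* r
T-closed zero    = ≡.refl
T-closed (suc r) = ≡.trans (lhs r (T r)) (≡.trans (≡.cong (ℕ._+ (18 ℕ.* r ℕ.+ 9)) (T-closed r)) (rhs r))
  where
  lhs : ∀ r t → (r ℕ.* 3 ℕ.+ (r ℕ.* 3 ℕ.+ (r ℕ.* 3 ℕ.+ (3 ℕ.+ t)))) ℕ.* 2 ℕ.+ 3 ℕ.* (1 ℕ.+ r)
              ≡ t ℕ.* 2 ℕ.+ 3 ℕ.* r ℕ.+ (18 ℕ.* r ℕ.+ 9)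
  lhs = ℕ-Solver.solve-∀
  rhs : ∀ r → 9 ℕ.* r ℕ.* r ℕ.+ (18 ℕ.* r ℕ.+ 9) ≡ 9 ℕ.* (1 ℕ.+ r) ℕ.* (1 ℕ.+ r)
  rhs = ℕ-Solver.solve-∀

-- The halved exponent is split into m powers of q and n powers of its inverse. The hypothesis is
-- the doubled equation with its negative terms moved across, hence an equation in ℕ.
half-⊖ : ∀ x k r m n → x ℕ.+ n ℕ.* 2 ≡ m ℕ.* 2 ℕ.+ k ℕ.* r →
         (ℤ.+ x ℤ.+ ℤ.- (ℤ.+ k) ℤ.* ℤ.+ r) ℤ./ℕ 2 ≡ m ℤ.⊖ n
half-⊖ x k r m n h = ≡.trans (≡.cong (ℤ._/ℕ 2) even) (/ℕ-exact (m ℤ.⊖ n))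
  where
  hℤ : ℤ.+ x ℤ.+ ℤ.+ n ℤ.* ℤ.+ 2 ≡ ℤ.+ m ℤ.* ℤ.+ 2 ℤ.+ ℤ.+ k ℤ.* ℤ.+ r
  hℤ rewrite ≡.sym (ℤ.pos-* n 2) | ≡.sym (ℤ.pos-* m 2) | ≡.sym (ℤ.pos-* k r) = ≡.cong ℤ.+_ h
  lhs : ∀ x n k r → x ℤ.+ ℤ.- k ℤ.* r ≡ (x ℤ.+ n ℤ.* ℤ.+ 2) ℤ.+ (ℤ.- (n ℤ.* ℤ.+ 2) ℤ.+ ℤ.- (k ℤ.* r))
  lhs = ℤ-Solver.solve-∀
  rhs : ∀ m n k r → (m ℤ.* ℤ.+ 2 ℤ.+ k ℤ.* r) ℤ.+ (ℤ.- (n ℤ.* ℤ.+ 2) ℤ.+ ℤ.- (k ℤ.* r))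
                  ≡ (m ℤ.+ ℤ.- n) ℤ.* ℤ.+ 2
  rhs = ℤ-Solver.solve-∀
  even : ℤ.+ x ℤ.+ ℤ.- (ℤ.+ k) ℤ.* ℤ.+ r ≡ (m ℤ.⊖ n) ℤ.* ℤ.+ 2
  even = ≡.trans (lhs (ℤ.+ x) (ℤ.+ n) (ℤ.+ k) (ℤ.+ r))
    (≡.trans (≡.cong (ℤ._+ (ℤ.- (ℤ.+ n ℤ.* ℤ.+ 2) ℤ.+ ℤ.- (ℤ.+ k ℤ.* ℤ.+ r))) hℤ)
    (≡.trans (rhs (ℤ.+ m) (ℤ.+ n) (ℤ.+ k) (ℤ.+ r))
             (≡.cong (ℤ._* ℤ.+ 2) (ℤ.m-n≡m⊖n m n))))

-- Field arithmetic, powers, Pochhammer symbols and finite sums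

module FieldLemmas {c ℓ} (F : Field c ℓ) where
  open Field F hiding (zero) public
  open FieldDefs F public using (_÷_; pow; zpow; poch; sumTo; BaileyPair; Knum; Kden; K)
  open IntegerSolver commutativeRing public
    using (solve; _:=_; _:+_; _:*_; _:-_; :-_; :0; :1; Polynomial; var; ⟦_⟧; ⟦⟧-cong)
  open import Relation.Binary.Reasoning.Setoid setoid public

  infix 4 _≉0
  _≉0 : Carrier → Set ℓ
  x ≉0 = ¬ (x ≈ 0#)

  ⁻¹-inverseˡ : ∀ x → x ≉0 → x ⁻¹ * x ≈ 1#
  ⁻¹-inverseˡ x x≉0 = trans (*-comm _ _) (⁻¹-inverse x x≉0)

  *-cancelˡ-≉0 : ∀ {x y z} → x ≉0 → x * y ≈ x * z → y ≈ z
  *-cancelˡ-≉0 {x} {y} {z} x≉0 xy≈xz = begin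
    y               ≈⟨ cancel y ⟨
    x ⁻¹ * (x * y)  ≈⟨ *-congˡ xy≈xz ⟩
    x ⁻¹ * (x * z)  ≈⟨ cancel z ⟩
    z               ∎
    where
    cancel : ∀ w → x ⁻¹ * (x * w) ≈ w
    cancel w = trans (sym (*-assoc _ _ _)) (trans (*-congʳ (⁻¹-inverseˡ x x≉0)) (*-identityˡ w))

  x*y≈0⇒y≈0 : ∀ {x y} → x ≉0 → x * y ≈ 0# → y ≈ 0#
  x*y≈0⇒y≈0 x≉0 xy≈0 = *-cancelˡ-≉0 x≉0 (trans xy≈0 (sym (zeroʳ _)))

  *-≉0 : ∀ {x y} → x ≉0 → y ≉0 → x * y ≉0
  *-≉0 x≉0 y≉0 xy≈0 = y≉0 (x*y≈0⇒y≈0 x≉0 xy≈0)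

  x*y≉0⇒x≉0 : ∀ {x y} → x * y ≉0 → x ≉0
  x*y≉0⇒x≉0 xy≉0 x≈0 = xy≉0 (trans (*-congʳ x≈0) (zeroˡ _))

  x*y≉0⇒y≉0 : ∀ {x y} → x * y ≉0 → y ≉0
  x*y≉0⇒y≉0 xy≉0 y≈0 = xy≉0 (trans (*-congˡ y≈0) (zeroʳ _))

  ≉0-resp : ∀ {x y} → x ≈ y → x ≉0 → y ≉0
  ≉0-resp x≈y x≉0 y≈0 = x≉0 (trans x≈y y≈0)

  x*y≈1⇒x≉0 : ∀ {x y} → x * y ≈ 1# → x ≉0
  x*y≈1⇒x≉0 xy≈1 = x*y≉0⇒x≉0 λ xy≈0 → 0≉1 (trans (sym xy≈0) xy≈1)

  1≉0 : 1# ≉0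
  1≉0 1≈0 = 0≉1 (sym 1≈0)

  ⁻¹-* : ∀ {x y} → x ≉0 → y ≉0 → (x * y) ⁻¹ ≈ x ⁻¹ * y ⁻¹
  ⁻¹-* {x} {y} x≉0 y≉0 = *-cancelˡ-≉0 (*-≉0 x≉0 y≉0) (begin
    (x * y) * (x * y) ⁻¹     ≈⟨ ⁻¹-inverse _ (*-≉0 x≉0 y≉0) ⟩
    1#                       ≈⟨ *-identityˡ 1# ⟨
    1# * 1#                  ≈⟨ *-cong (⁻¹-inverse x x≉0) (⁻¹-inverse y y≉0) ⟨
    x * x ⁻¹ * (y * y ⁻¹)    ≈⟨ solve 4 (λ x x′ y y′ →
        x :* x′ :* (y :* y′)
        := (x :* y) :* (x′ :* y′))
        refl x (x ⁻¹) y (y ⁻¹) ⟩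
    (x * y) * (x ⁻¹ * y ⁻¹)  ∎)

  1⁻¹≈1 : 1# ⁻¹ ≈ 1#
  1⁻¹≈1 = trans (sym (*-identityˡ _)) (⁻¹-inverse 1# 1≉0)

  1≈1÷[1*1] : 1# ≈ 1# ÷ (1# * 1#)
  1≈1÷[1*1] = sym (trans (*-identityˡ _) (trans (⁻¹-cong (*-identityˡ 1#)) 1⁻¹≈1))

  x*y≈k*z⇒k*[z÷x]≈y : ∀ {x y z k} → x ≉0 → x * y ≈ k * z → k * (z ÷ x) ≈ y
  x*y≈k*z⇒k*[z÷x]≈y {x} {y} {z} {k} x≉0 h = *-cancelˡ-≉0 x≉0 (begin
    x * (k * (z * x ⁻¹))  ≈⟨ solve 4 (λ x k z i →
        x :* (k :* (z :* i))
        := (x :* i) :* (k :* z))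
        refl x k z (x ⁻¹) ⟩
    (x * x ⁻¹) * (k * z)  ≈⟨ *-cong (⁻¹-inverse x x≉0) (sym h) ⟩
    1# * (x * y)          ≈⟨ *-identityˡ _ ⟩
    x * y                 ∎)

  -- Substituting an equation l ≈ r into an identity that holds only modulo it.
  modulo : ∀ {l r} c {A B} → l ≈ r → A ≈ B + c * (l - r) → A ≈ B
  modulo {l} {r} c {A} {B} l≈r h = begin
    A                ≈⟨ h ⟩
    B + c * (l - r)  ≈⟨ +-congˡ (*-congˡ (+-congʳ l≈r)) ⟩
    B + c * (r - r)  ≈⟨ solve 3 (λ B c r → B :+ c :* (r :- r) := B) refl B c r ⟩
    B                ∎

  x-y≈0⇒x≈y : ∀ {x y} → x - y ≈ 0# → x ≈ y
  x-y≈0⇒x≈y {x} {y} h = modulo 1# h (solve 2 (λ x y → x := y :+ :1 :* ((x :- y) :- :0)) refl x y)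

  pow-cong : ∀ {x y} n → x ≈ y → pow x n ≈ pow y n
  pow-cong zero    _   = refl
  pow-cong (suc n) x≈y = *-cong x≈y (pow-cong n x≈y)

  pow-+ : ∀ x m n → pow x (m ℕ.+ n) ≈ pow x m * pow x n
  pow-+ x zero    n = sym (*-identityˡ _)
  pow-+ x (suc m) n = trans (*-congˡ (pow-+ x m n)) (sym (*-assoc _ _ _))

  pow-* : ∀ x y n → pow (x * y) n ≈ pow x n * pow y n
  pow-* x y zero    = sym (*-identityˡ _)
  pow-* x y (suc n) = trans (*-congˡ (pow-* x y n))
    (solve 4 (λ x y m n → x :* y :* (m :* n) := x :* m :* (y :* n)) refl x y (pow x n) (pow y n))

  pow-1# : ∀ n → pow 1# n ≈ 1#
  pow-1# zero    = refl
  pow-1# (suc n) = trans (*-identityˡ _) (pow-1# n)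

  pow-inverse : ∀ {x y} n → x * y ≈ 1# → pow x n * pow y n ≈ 1#
  pow-inverse {x} {y} n xy≈1 = trans (sym (pow-* x y n)) (trans (pow-cong n xy≈1) (pow-1# n))

  zpow-⊖ : ∀ {x} → x ≉0 → ∀ m n → zpow x (m ℤ.⊖ n) ≈ pow x m * pow (x ⁻¹) n
  zpow-⊖ x≉0 m       zero    = sym (*-identityʳ _)
  zpow-⊖ x≉0 zero    (suc n) = sym (*-identityˡ _)
  zpow-⊖ {x} x≉0 (suc m) (suc n) = begin
    zpow x (suc m ℤ.⊖ suc n)            ≡⟨ ≡.cong (zpow x) (ℤ.[1+m]⊖[1+n]≡m⊖n m n) ⟩
    zpow x (m ℤ.⊖ n)                    ≈⟨ zpow-⊖ x≉0 m n ⟩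
    pow x m * pow (x ⁻¹) n              ≈⟨ *-identityˡ _ ⟨
    1# * (pow x m * pow (x ⁻¹) n)       ≈⟨ *-congʳ (⁻¹-inverse x x≉0) ⟨
    x * x ⁻¹ * (pow x m * pow (x ⁻¹) n)
      ≈⟨ solve 4 (λ x y m n →
          x :* y :* (m :* n)
          := x :* m :* (y :* n))
          refl x (x ⁻¹) (pow x m) (pow (x ⁻¹) n) ⟩
    pow x (suc m) * pow (x ⁻¹) (suc n)  ∎

  poch-cong : ∀ {x y} q n → x ≈ y → poch x q n ≈ poch y q n
  poch-cong q zero    _   = refl
  poch-cong q (suc n) x≈y = *-cong (poch-cong q n x≈y) (+-congˡ (-‿cong (*-congʳ x≈y)))

  poch-shift : ∀ x q n → (1# - x) * poch (x * q) q n ≈ poch x q (suc n)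
  poch-shift x q zero    = solve 1 (λ x → (:1 :- x) :* :1 := :1 :* (:1 :- x :* :1)) refl x
  poch-shift x q (suc n) = begin
    (1# - x) * (poch (x * q) q n * (1# - x * q * pow q n))
      ≈⟨ solve 4 (λ x q P Q →
          (:1 :- x) :* (P :* (:1 :- x :* q :* Q))
          := (:1 :- x) :* P :* (:1 :- x :* (q :* Q)))
          refl x q (poch (x * q) q n) (pow q n) ⟩
    (1# - x) * poch (x * q) q n * (1# - x * (q * pow q n))
      ≈⟨ *-congʳ (poch-shift x q n) ⟩
    poch x q (suc n) * (1# - x * (q * pow q n))  ∎

  poch-factor-≉0 : ∀ {x q} → (∀ n → poch x q n ≉0) → ∀ n → 1# - x * pow q n ≉0
  poch-factor-≉0 h n = x*y≉0⇒y≉0 (h (suc n))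

  1-x≉0 : ∀ {x q} → (∀ n → poch x q n ≉0) → 1# - x ≉0
  1-x≉0 h = ≉0-resp (+-congˡ (-‿cong (*-identityʳ _))) (poch-factor-≉0 h 0)

  sumTo-cong : ∀ {f g} n → (∀ j → j ≤ n → f j ≈ g j) → sumTo f n ≈ sumTo g n
  sumTo-cong zero    h = h 0 z≤n
  sumTo-cong (suc n) h =
    +-cong (sumTo-cong n λ j j≤n → h j (ℕ.m≤n⇒m≤1+n j≤n)) (h (suc n) ℕ.≤-refl)

  sumTo-+ : ∀ f g n → sumTo (λ j → f j + g j) n ≈ sumTo f n + sumTo g n
  sumTo-+ f g zero    = refl
  sumTo-+ f g (suc n) = trans (+-congʳ (sumTo-+ f g n))
    (solve 4 (λ a b c d →
        a :+ b :+ (c :+ d)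
        := a :+ c :+ (b :+ d))
        refl (sumTo f n) (sumTo g n) (f (suc n)) (g (suc n)))

  sumTo-* : ∀ c f n → sumTo (λ j → c * f j) n ≈ c * sumTo f n
  sumTo-* c f zero    = refl
  sumTo-* c f (suc n) = trans (+-congʳ (sumTo-* c f n)) (sym (distribˡ _ _ _))

  sumTo-telescope : ∀ (f : ℕ → Carrier) n → sumTo (λ j → f (suc j) - f j) n ≈ f (suc n) - f 0
  sumTo-telescope f zero    = refl
  sumTo-telescope f (suc n) = trans (+-congʳ (sumTo-telescope f n))
    (solve 3 (λ a b c → b :- a :+ (c :- b) := c :- a) refl (f 0) (f (suc n)) (f (suc (suc n))))

  sumTo-extend : ∀ {f} k n → (∀ j → n < j → f j ≈ 0#) → sumTo f (k ℕ.+ n) ≈ sumTo f n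
  sumTo-extend zero    n h = refl
  sumTo-extend (suc k) n h =
    trans (+-cong (sumTo-extend k n h) (h _ (s≤s (ℕ.m≤n+m n k)))) (+-identityʳ _)

  sumTo-triples : ∀ (f : ℕ → Carrier) r → sumTo f (2 ℕ.+ r ℕ.* 3) ≈
    sumTo (λ r → f (r ℕ.* 3) + f (1 ℕ.+ r ℕ.* 3) + f (2 ℕ.+ r ℕ.* 3)) r
  sumTo-triples f zero    = refl
  sumTo-triples f (suc r) = trans
    (solve 4 (λ s a b c →
        s :+ a :+ b :+ c
        := s :+ (a :+ b :+ c))
        refl (sumTo f (2 ℕ.+ r ℕ.* 3)) (f (suc r ℕ.* 3)) (f (1 ℕ.+ suc r ℕ.* 3))
        (f (2 ℕ.+ suc r ℕ.* 3)))
    (+-congʳ (sumTo-triples f r))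

  record Nonvanishing (q : Carrier) : Set ℓ where
    field
      q≉0  : q ≉0
      qq≉0 : ∀ m → poch q q m ≉0
      p≉0  : ∀ m → poch (pow q 3) (pow q 3) m ≉0

  record NonvanishingAt (q a : Carrier) : Set ℓ where
    field
      aq≉0  : ∀ m → poch a q m ≉0
      aqq≉0 : ∀ m → poch (a * q) q m ≉0

-- The Bailey kernel along j = 3r and the hypergeometric summand

module Base {c ℓ} (F : Field c ℓ) (q : Field.Carrier F)
            (nonvanishing : FieldLemmas.Nonvanishing F q) where
  open FieldLemmas F
  open Nonvanishing nonvanishing public

  q⁻ p : Carrier
  q⁻ = q ⁻¹
  p = pow q 3

  z z⁻ : ℕ → Carrier
  z r = pow q (r ℕ.* 3)
  z⁻ r = pow q⁻ (r ℕ.* 3)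

  qq⁻≈1 : q * q⁻ ≈ 1#
  qq⁻≈1 = ⁻¹-inverse q q≉0

  zz⁻≈1 : ∀ r → z r * z⁻ r ≈ 1#
  zz⁻≈1 r = pow-inverse (r ℕ.* 3) qq⁻≈1

  pow-p : ∀ r → pow p r ≈ z r
  pow-p zero    = refl
  pow-p (suc r) = trans (*-congˡ (pow-p r)) (solve 2 (λ q z →
      q :* (q :* (q :* :1)) :* z
      := q :* (q :* (q :* z)))
      refl q (z r))

  pow-p-cube : ∀ n → pow p n ≈ pow q n * pow q n * pow q n
  pow-p-cube zero    = solve 1 (λ q → :1 := :1 :* :1 :* :1) refl q
  pow-p-cube (suc n) = trans (*-congˡ (pow-p-cube n))
    (solve 2 (λ q N →
        q :* (q :* (q :* :1)) :* (N :* N :* N)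
        := (q :* N) :* (q :* N) :* (q :* N))
        refl q (pow q n))

  -- iq n j is 1/(q;q)_{n−j}, which is 0 for j > n.
  iq : ℕ → ℕ → Carrier
  iq n       zero    = poch q q n ⁻¹
  iq zero    (suc j) = 0#
  iq (suc n) (suc j) = iq n j

  iq-≤ : ∀ {n j} → j ≤ n → iq n j ≡ poch q q (n ∸ j) ⁻¹
  iq-≤ z≤n       = ≡.refl
  iq-≤ (s≤s j≤n) = iq-≤ j≤n

  iq-> : ∀ {n j} → n < j → iq n j ≡ 0#
  iq-> {zero}  (s≤s _)   = ≡.refl
  iq-> {suc n} (s≤s n<j) = iq-> n<j

  -- Splits off the last factor of (q;q)_(n+1-j), multiplied by q^j so that no truncated difference
  -- occurs. At j = n + 1 the left side is 0 by `iq` and the right side by its bracket.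
  iq-row : ∀ n j → pow q j * iq n j ≈ (pow q j - pow q (suc n)) * iq (suc n) j
  iq-row n zero = begin
    1# * poch q q n ⁻¹                                    ≈⟨ *-congʳ (⁻¹-inverse _ f≉0) ⟨
    (1# - q * N) * (1# - q * N) ⁻¹ * poch q q n ⁻¹
      ≈⟨ solve 3 (λ f f′ P →
          f :* f′ :* P
          := f :* (P :* f′))
          refl (1# - q * N) ((1# - q * N) ⁻¹) (poch q q n ⁻¹) ⟩
    (1# - q * N) * (poch q q n ⁻¹ * (1# - q * N) ⁻¹)      ≈⟨ *-congˡ (⁻¹-* (qq≉0 n) f≉0) ⟨
    (1# - q * N) * (poch q q n * (1# - q * N)) ⁻¹         ∎
    where
    N = pow q n
    f≉0 : 1# - q * N ≉0
    f≉0 = poch-factor-≉0 qq≉0 n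
  iq-row zero    (suc zero)    = trans (zeroʳ _) (sym (trans (*-congʳ (-‿inverseʳ _)) (zeroˡ _)))
  iq-row zero    (suc (suc j)) = trans (zeroʳ _) (sym (zeroʳ _))
  iq-row (suc n) (suc j)       = begin
    q * pow q j * iq n j                                       ≈⟨ *-assoc _ _ _ ⟩
    q * (pow q j * iq n j)                                     ≈⟨ *-congˡ (iq-row n j) ⟩
    q * ((pow q j - pow q (suc n)) * iq (suc n) j)
      ≈⟨ solve 4 (λ q Q M x →
          q :* ((Q :- M) :* x)
          := (q :* Q :- q :* M) :* x)
          refl q (pow q j) (pow q (suc n)) (iq (suc n) j) ⟩
    (q * pow q j - q * pow q (suc n)) * iq (suc n) j  ∎

  -- Raising j amounts to lowering n, since `iq` depends only on their difference; for positive n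
  -- this is literally `iq-row`.
  iq-step : ∀ n j → pow q j * iq n (suc j) ≈ (pow q j - pow q n) * iq n j
  iq-step zero    zero    = trans (zeroʳ _) (sym (trans (*-congʳ (-‿inverseʳ _)) (zeroˡ _)))
  iq-step zero    (suc j) = trans (zeroʳ _) (sym (zeroʳ _))
  iq-step (suc n) j       = iq-row n j

  iq-step³ : ∀ n j → let Q = pow q j; M = pow q n in
    Q * (q * Q) * (q * (q * Q)) * iq n (3 ℕ.+ j) ≈ (Q - M) * (q * Q - M) * (q * (q * Q) - M) * iq n j
  iq-step³ n j = begin
    Q * (q * Q) * (q * (q * Q)) * iq n (3 ℕ.+ j)
      ≈⟨ *-assoc _ _ _ ⟩
    Q * (q * Q) * (q * (q * Q) * iq n (3 ℕ.+ j))
      ≈⟨ *-congˡ (iq-step n (2 ℕ.+ j)) ⟩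
    Q * (q * Q) * ((q * (q * Q) - M) * iq n (2 ℕ.+ j))
      ≈⟨ solve 4 (λ Q R S x →
          Q :* R :* (S :* x)
          := Q :* S :* (R :* x))
          refl Q (q * Q) (q * (q * Q) - M) (iq n (2 ℕ.+ j)) ⟩
    Q * (q * (q * Q) - M) * (q * Q * iq n (2 ℕ.+ j))
      ≈⟨ *-congˡ (iq-step n (1 ℕ.+ j)) ⟩
    Q * (q * (q * Q) - M) * ((q * Q - M) * iq n (1 ℕ.+ j))
      ≈⟨ solve 4 (λ Q R S x →
          Q :* R :* (S :* x)
          := S :* R :* (Q :* x))
          refl Q (q * (q * Q) - M) (q * Q - M) (iq n (1 ℕ.+ j)) ⟩
    (q * Q - M) * (q * (q * Q) - M) * (Q * iq n (1 ℕ.+ j))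
      ≈⟨ *-congˡ (iq-step n j) ⟩
    (q * Q - M) * (q * (q * Q) - M) * ((Q - M) * iq n j)
      ≈⟨ solve 4 (λ S R Q x →
          S :* R :* (Q :* x)
          := Q :* S :* R :* x)
          refl (q * Q - M) (q * (q * Q) - M) (Q - M) (iq n j) ⟩
    (Q - M) * (q * Q - M) * (q * (q * Q) - M) * iq n j  ∎
    where
    Q = pow q j
    M = pow q n

  module WellPoised (a : Carrier) (nonvanishingAt : NonvanishingAt q a) where
    open NonvanishingAt nonvanishingAt public

    ia : ℕ → Carrier
    ia m = poch (a * q) q m ⁻¹

    ia-step : ∀ m → ia m ≈ (1# - a * q * pow q m) * ia (suc m)
    ia-step m = begin
      ia m                                ≈⟨ *-identityˡ _ ⟨
      1# * ia m                           ≈⟨ *-congʳ (⁻¹-inverse _ f≉0) ⟨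
      f * f ⁻¹ * ia m                     ≈⟨ solve 3 (λ f f′ P →
          f :* f′ :* P
          := f :* (P :* f′))
          refl f (f ⁻¹) (ia m) ⟩
      f * (ia m * f ⁻¹)                   ≈⟨ *-congˡ (⁻¹-* (aqq≉0 m) f≉0) ⟨
      f * ia (suc m)                      ∎
      where
      f = 1# - a * q * pow q m
      f≉0 : f ≉0
      f≉0 = poch-factor-≉0 aqq≉0 m

    ia-step³ : ∀ m → let Q = pow q m in
      ia m ≈ (1# - a * q * Q) * (1# - a * q * (q * Q)) * (1# - a * q * (q * (q * Q))) * ia (3 ℕ.+ m)
    ia-step³ m = begin
      ia m                                   ≈⟨ ia-step m ⟩
      f 0 * ia (1 ℕ.+ m)                     ≈⟨ *-congˡ (ia-step (1 ℕ.+ m)) ⟩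
      f 0 * (f 1 * ia (2 ℕ.+ m))             ≈⟨ *-congˡ (*-congˡ (ia-step (2 ℕ.+ m))) ⟩
      f 0 * (f 1 * (f 2 * ia (3 ℕ.+ m)))     ≈⟨ solve 4 (λ x y z i →
          x :* (y :* (z :* i))
          := x :* y :* z :* i)
          refl (f 0) (f 1) (f 2) (ia (3 ℕ.+ m)) ⟩
      f 0 * f 1 * f 2 * ia (3 ℕ.+ m)         ∎
      where
      f : ℕ → Carrier
      f k = 1# - a * q * pow q (k ℕ.+ m)

    I : ℕ → ℕ → Carrier
    I n r = iq n (r ℕ.* 3) * ia (r ℕ.* 3 ℕ.+ n)

    -- As in `I-next`, the neighbour is expressed through `I (suc n) r`. In the WZ equation this
    -- becomes a common factor, and a polynomial identity remains.
    I-row : ∀ n r → let N = pow q n in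
      z r * I n r ≈ (z r - q * N) * (1# - a * N * q * z r) * I (suc n) r
    I-row n r = begin
      z r * (iq n (r ℕ.* 3) * ia m)
        ≈⟨ *-assoc _ _ _ ⟨
      z r * iq n (r ℕ.* 3) * ia m
        ≈⟨ *-cong (iq-row n (r ℕ.* 3)) (ia-step m) ⟩
      (z r - q * N) * iq (suc n) (r ℕ.* 3) * ((1# - a * q * pow q m) * ia (suc m))
        ≈⟨ *-congˡ (*-cong (+-congˡ (-‿cong (*-congˡ (pow-+ q (r ℕ.* 3) n))))
                           (reflexive (≡.cong ia (≡.sym (ℕ.+-suc (r ℕ.* 3) n))))) ⟩
      (z r - q * N) * iq (suc n) (r ℕ.* 3) * ((1# - a * q * (z r * N)) * ia (r ℕ.* 3 ℕ.+ suc n))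
        ≈⟨ solve 6 (λ z q N a x y →
            (z :- q :* N) :* x :* ((:1 :- a :* q :* (z :* N)) :* y)
            := (z :- q :* N) :* (:1 :- a :* N :* q :* z) :* (x :* y))
            refl (z r) q N a (iq (suc n) (r ℕ.* 3)) (ia (r ℕ.* 3 ℕ.+ suc n)) ⟩
      (z r - q * N) * (1# - a * N * q * z r) * I (suc n) r  ∎
      where
      N = pow q n
      m = r ℕ.* 3 ℕ.+ n

    I-next : ∀ n r → let N = pow q n; Z = z r in
      q * (Z * Z * Z) * ((1# - a * N * (q * q) * Z) * (1# - a * N * (q * q * q) * Z)
        * (1# - a * N * (q * q * q * q) * Z) * I (suc n) (suc r))
      ≈ (Z - N * q) * (Z - N) * (q * Z - N) * I (suc n) r
    -- In row n + 1 the three factors of `iq-step³` leave a surplus q² on both sides.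
    I-next n r = *-cancelˡ-≉0 (*-≉0 q≉0 q≉0) (begin
      q * q * (q * (Z * Z * Z) * (P * I (suc n) (suc r)))
        ≈⟨ solve 5 (λ q Z P x y →
            q :* q :* (q :* (Z :* Z :* Z) :* (P :* (x :* y)))
            := (Z :* (q :* Z) :* (q :* (q :* Z)) :* x) :* (P :* y))
            refl q Z P (iq (suc n) (suc r ℕ.* 3)) (ia (suc r ℕ.* 3 ℕ.+ suc n)) ⟩
      Z * (q * Z) * (q * (q * Z)) * iq (suc n) (suc r ℕ.* 3) * (P * ia (suc r ℕ.* 3 ℕ.+ suc n))
        ≈⟨ *-cong (iq-step³ (suc n) (r ℕ.* 3)) (*-congʳ P≈P′) ⟩
      (Z - q * N) * (q * Z - q * N) * (q * (q * Z) - q * N) * iq (suc n) (r ℕ.* 3) * (P′ * ia (suc r ℕ.* 3 ℕ.+ suc n))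
        ≈⟨ *-congˡ (ia-step³ (r ℕ.* 3 ℕ.+ suc n)) ⟨
      (Z - q * N) * (q * Z - q * N) * (q * (q * Z) - q * N) * iq (suc n) (r ℕ.* 3) * ia (r ℕ.* 3 ℕ.+ suc n)
        ≈⟨ solve 5 (λ q Z N x y →
            (Z :- q :* N) :* (q :* Z :- q :* N) :* (q :* (q :* Z) :- q :* N) :* x :* y
            := q :* q :* ((Z :- N :* q) :* (Z :- N) :* (q :* Z :- N) :* (x :* y)))
            refl q Z N (iq (suc n) (r ℕ.* 3)) (ia (r ℕ.* 3 ℕ.+ suc n)) ⟩
      q * q * ((Z - N * q) * (Z - N) * (q * Z - N) * I (suc n) r)  ∎)
      where
      N = pow q n
      Z = z r
      Q = pow q (r ℕ.* 3 ℕ.+ suc n)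
      P = (1# - a * N * (q * q) * Z) * (1# - a * N * (q * q * q) * Z) * (1# - a * N * (q * q * q * q) * Z)
      P′ = (1# - a * q * Q) * (1# - a * q * (q * Q)) * (1# - a * q * (q * (q * Q)))
      P≈P′ : P ≈ P′
      P≈P′ = trans
        (solve 4 (λ a N q Z →
            (:1 :- a :* N :* (q :* q) :* Z) :* (:1 :- a :* N :* (q :* q :* q) :* Z) :* (:1 :- a :* N
            :* (q :* q :* q :* q) :* Z)
            := (:1 :- a :* q :* (Z :* (q :* N))) :* (:1 :- a :* q :* (q :* (Z :* (q :* N)))) :* (:1
               :- a :* q :* (q :* (q :* (Z :* (q :* N))))))
            refl a N q Z)
        (sym (*-cong (*-cong (fac Q≈) (fac (*-congˡ Q≈))) (fac (*-congˡ (*-congˡ Q≈)))))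
        where
        Q≈ : Q ≈ Z * (q * N)
        Q≈ = pow-+ q (r ℕ.* 3) (suc n)
        fac : ∀ {x y} → x ≈ y → 1# - a * q * x ≈ 1# - a * q * y
        fac h = +-congˡ (-‿cong (*-congˡ h))

    I-vanish : ∀ {n r} → n < r ℕ.* 3 → I n r ≈ 0#
    I-vanish n<3r = trans (*-congʳ (reflexive (iq-> n<3r))) (zeroˡ _)

    ip : ℕ → Carrier
    ip r = poch p p r ⁻¹

    -- The very-well-poised factor 1 - a z² is left to `f`, because the WZ certificate contains the
    -- summand without it.
    H : ℕ → Carrier
    H r = poch a p r * ip r * pow (- a) r * pow q (T r)

    f : ℕ → Carrier
    f r = (1# - a * (z r * z r)) * H r

    H-next : ∀ r → let Z = z r in
      (1# - q * (q * (q * Z))) * H (suc r) ≈ - ((1# - a * Z) * a * (q * q * q * (Z * Z * Z)) * H r)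
    H-next r = begin
      g * (poch a p r * (1# - a * pow p r) * ip (suc r) * (- a * A) * pow q (T (suc r)))
        ≈⟨ *-congˡ (*-cong (*-congʳ (*-congʳ (*-congˡ (+-congˡ (-‿cong (*-congˡ (pow-p r))))))) powT) ⟩
      g * (poch a p r * (1# - a * Z) * ip (suc r) * (- a * A) * (Z * (Z * (Z * (q * (q * (q * B)))))))
        ≈⟨ solve 8 (λ g P a Z i A q B →
            g :* (P :* (:1 :- a :* Z) :* i :* (:- a :* A) :* (Z :* (Z :* (Z :* (q :* (q :* (q :*
            B)))))))
            := :- ((:1 :- a :* Z) :* a :* (q :* q :* q :* (Z :* Z :* Z)) :* (P :* (g :* i) :* A :*
               B)))
            refl g (poch a p r) a Z (ip (suc r)) A q B ⟩
      - ((1# - a * Z) * a * (q * q * q * (Z * Z * Z)) * (poch a p r * (g * ip (suc r)) * A * B))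
        ≈⟨ -‿cong (*-congˡ (*-congʳ (*-congʳ (*-congˡ ip-next)))) ⟩
      - ((1# - a * Z) * a * (q * q * q * (Z * Z * Z)) * H r)  ∎
      where
      Z = z r
      A = pow (- a) r
      B = pow q (T r)
      g = 1# - q * (q * (q * Z))
      g′ = 1# - p * pow p r
      g≈g′ : g ≈ g′
      g≈g′ = +-congˡ (-‿cong (sym (pow-p (suc r))))
      g′≉0 : g′ ≉0
      g′≉0 = poch-factor-≉0 p≉0 r
      ip-next : g * ip (suc r) ≈ ip r
      ip-next = begin
        g * ip (suc r)             ≈⟨ *-cong g≈g′ (⁻¹-* (p≉0 r) g′≉0) ⟩
        g′ * (ip r * g′ ⁻¹)        ≈⟨ solve 3 (λ g i h →
            g :* (i :* h)
            := g :* h :* i)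
            refl g′ (ip r) (g′ ⁻¹) ⟩
        g′ * g′ ⁻¹ * ip r          ≈⟨ *-congʳ (⁻¹-inverse _ g′≉0) ⟩
        1# * ip r                  ≈⟨ *-identityˡ _ ⟩
        ip r                       ∎
      powT : pow q (T (suc r)) ≈ Z * (Z * (Z * (q * (q * (q * B)))))
      powT = trans (pow-+ q j _) (*-congˡ (trans (pow-+ q j _) (*-congˡ (pow-+ q j _))))
        where j = r ℕ.* 3

-- Closed form of the unweighted sum

module Summation {c ℓ} (F : Field c ℓ) (q : Field.Carrier F)
                 (nonvanishing : FieldLemmas.Nonvanishing F q) (a : Field.Carrier F)
                 (nonvanishingAt : FieldLemmas.NonvanishingAt F q a) where
  open FieldLemmas F
  open Base F q nonvanishing
  open WellPoised a nonvanishingAt public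

  -- The upper limit R is independent of n: terms with 3r > n vanish, so the sums for consecutive n
  -- can be compared term by term over one range.
  S : (ℕ → Carrier) → ℕ → ℕ → Carrier
  S g R n = sumTo (λ r → g r * I n r) R

  -- By `Bden-next`, the factor by which the denominator of `B` grows from n to n + 1.
  D : Carrier → Carrier
  D N = (1# - a * (N * N)) * (1# - a * (N * N) * q) * (1# - N * q)

  -- The WZ certificate for the summand f r * I n r.
  G : ℕ → ℕ → Carrier
  G n r = let N = pow q n; Z = z r in
    - (N * (1# - Z) * (1# - a * N * q * Z) * (1# - a * N * Z) * (q - a * N * Z) * z⁻ r * (H r * I (suc n) r))

  -- The shift replaces Z by q³Z. The factor 1 - q³Z then clears the denominator of the ratio of
  -- consecutive `H`, and the three factors containing a N Z become, up to one q, those absorbed by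
  -- `I-next`.
  G-next : ∀ n r → let N = pow q n; Z = z r in
    G n (suc r) ≈ N * a * z⁻ r * (1# - a * Z) * ((Z - N * q) * (Z - N) * (q * Z - N)) * (H r * I (suc n) r)
  G-next n r = begin
    G n (suc r)
      ≈⟨ solve 8 (λ N q q⁻ a Z Z⁻ h x →
          :- (N :* (:1 :- q :* (q :* (q :* Z))) :* (:1 :- a :* N :* q :* (q :* (q :* (q :* Z)))) :*
          (:1 :- a :* N :* (q :* (q :* (q :* Z)))) :* (q :- a :* N :* (q :* (q :* (q :* Z)))) :* (q⁻
          :* (q⁻ :* (q⁻ :* Z⁻))) :* (h :* x))
          := :- (N :* q :* (q⁻ :* q⁻ :* q⁻ :* Z⁻) :* ((:1 :- q :* (q :* (q :* Z))) :* h) :* ((:1 :-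
             a :* N :* (q :* q) :* Z) :* (:1 :- a :* N :* (q :* q :* q) :* Z) :* (:1 :- a :* N :* (q
             :* q :* q :* q) :* Z) :* x)))
          refl N q q⁻ a Z Z⁻ (H (suc r)) (I (suc n) (suc r)) ⟩
    - (N * q * (q⁻ * q⁻ * q⁻ * Z⁻) * ((1# - q * (q * (q * Z))) * H (suc r)) * x)
      ≈⟨ -‿cong (*-congʳ (*-congˡ (H-next r))) ⟩
    - (N * q * (q⁻ * q⁻ * q⁻ * Z⁻) * - ((1# - a * Z) * a * (q * q * q * (Z * Z * Z)) * H r) * x)
      ≈⟨ solve 8 (λ N q q⁻ a Z Z⁻ h x →
          :- (N :* q :* (q⁻ :* q⁻ :* q⁻ :* Z⁻) :* :- ((:1 :- a :* Z) :* a :* (q :* q :* q :* (Z :* Z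
          :* Z)) :* h) :* x)
          := N :* a :* Z⁻ :* (:1 :- a :* Z) :* ((q :* q⁻) :* (q :* q⁻) :* (q :* q⁻)) :* h :* (q :*
             (Z :* Z :* Z) :* x))
          refl N q q⁻ a Z Z⁻ (H r) x ⟩
    N * a * Z⁻ * (1# - a * Z) * ((q * q⁻) * (q * q⁻) * (q * q⁻)) * H r * (q * (Z * Z * Z) * x)
      ≈⟨ *-cong (*-congʳ (*-congˡ (*-cong (*-cong qq⁻≈1 qq⁻≈1) qq⁻≈1))) (I-next n r) ⟩
    N * a * Z⁻ * (1# - a * Z) * (1# * 1# * 1#) * H r * ((Z - N * q) * (Z - N) * (q * Z - N) * I (suc n) r)
      ≈⟨ solve 4 (λ k h y x →
          k :* (:1 :* :1 :* :1) :* h :* (y :* x)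
          := k :* y :* (h :* x))
          refl (N * a * Z⁻ * (1# - a * Z)) (H r) ((Z - N * q) * (Z - N) * (q * Z - N)) (I (suc n) r) ⟩
    N * a * Z⁻ * (1# - a * Z) * ((Z - N * q) * (Z - N) * (q * Z - N)) * (H r * I (suc n) r)  ∎
    where
    N = pow q n
    Z = z r
    Z⁻ = z⁻ r
    x = (1# - a * N * (q * q) * Z) * (1# - a * N * (q * q * q) * Z) * (1# - a * N * (q * q * q * q) * Z)
        * I (suc n) (suc r)

  I-row′ : ∀ n r → let N = pow q n; Z = z r in
    I n r ≈ z⁻ r * ((Z - q * N) * (1# - a * N * q * Z) * I (suc n) r)
  I-row′ n r = begin
    I n r                 ≈⟨ *-identityˡ _ ⟨
    1# * I n r            ≈⟨ *-congʳ (zz⁻≈1 r) ⟨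
    z r * z⁻ r * I n r    ≈⟨ solve 3 (λ x y i →
        x :* y :* i
        := y :* (x :* i))
        refl (z r) (z⁻ r) (I n r) ⟩
    z⁻ r * (z r * I n r)  ≈⟨ *-congˡ (I-row n r) ⟩
    z⁻ r * ((z r - q * N) * (1# - a * N * q * z r) * I (suc n) r)  ∎
    where N = pow q n

  wz : ∀ n r → let N = pow q n in
    D N * (f r * I (suc n) r) + (- (1# - a * (N * N * N))) * (f r * I n r) ≈ G n (suc r) - G n r
  wz n r = begin
    D N * (f r * x) + (- (1# - a * (N * N * N))) * (f r * I n r)
      ≈⟨ +-congˡ (*-congˡ (*-congˡ (I-row′ n r))) ⟩
    D N * (f r * x) + (- (1# - a * (N * N * N))) * (f r * (Z⁻ * ((Z - q * N) * (1# - a * N * q * Z) * x)))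
      -- All terms except the first carry a factor Z⁻. The cofactor supplies Z * Z⁻ to that one,
      -- after which the identity is polynomial.
      ≈⟨ modulo (- ((1# - a * (Z * Z)) * D N * (h * x))) (zz⁻≈1 r)
           (solve 7 (λ N q a Z Z⁻ h x →
               (:1 :- a :* (N :* N)) :* (:1 :- a :* (N :* N) :* q) :* (:1 :- N :* q) :* ((:1 :- a :*
               (Z :* Z)) :* h :* x) :+ (:- (:1 :- a :* (N :* N :* N))) :* ((:1 :- a :* (Z :* Z)) :*
               h :* (Z⁻ :* ((Z :- q :* N) :* (:1 :- a :* N :* q :* Z) :* x)))
               := N :* a :* Z⁻ :* (:1 :- a :* Z) :* ((Z :- N :* q) :* (Z :- N) :* (q :* Z :- N)) :*
                  (h :* x) :- (:- (N :* (:1 :- Z) :* (:1 :- a :* N :* q :* Z) :* (:1 :- a :* N :* Z)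
                  :* (q :- a :* N :* Z) :* Z⁻ :* (h :* x))) :+ (:- ((:1 :- a :* (Z :* Z)) :* ((:1 :-
                  a :* (N :* N)) :* (:1 :- a :* (N :* N) :* q) :* (:1 :- N :* q)) :* (h :* x))) :*
                  (Z :* Z⁻ :- :1))
               refl N q a Z Z⁻ h x) ⟩
    N * a * Z⁻ * (1# - a * Z) * ((Z - N * q) * (Z - N) * (q * Z - N)) * (h * x) - G n r
      ≈⟨ +-congʳ (G-next n r) ⟨
    G n (suc r) - G n r  ∎
    where
    N = pow q n
    Z = z r
    Z⁻ = z⁻ r
    h = H r
    x = I (suc n) r

  S-rec : ∀ {n R} → n ≤ R → let N = pow q n in
    D N * S f R (suc n) ≈ (1# - a * (N * N * N)) * S f R n
  S-rec {n} {R} n≤R = x-y≈0⇒x≈y (begin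
    D N * S f R (suc n) - k * S f R n
      ≈⟨ solve 4 (λ d s k t →
          d :* s :- k :* t
          := d :* s :+ (:- k) :* t)
          refl (D N) (S f R (suc n)) k (S f R n) ⟩
    D N * S f R (suc n) + (- k) * S f R n
      ≈⟨ +-cong (sumTo-* _ _ R) (sumTo-* _ _ R) ⟨
    sumTo (λ r → D N * (f r * I (suc n) r)) R + sumTo (λ r → (- k) * (f r * I n r)) R
      ≈⟨ sumTo-+ _ _ R ⟨
    sumTo (λ r → D N * (f r * I (suc n) r) + (- k) * (f r * I n r)) R
      ≈⟨ sumTo-cong R (λ r _ → wz n r) ⟩
    sumTo (λ r → G n (suc r) - G n r) R
      ≈⟨ sumTo-telescope (G n) R ⟩
    G n (suc R) - G n 0
      -- The upper end vanishes because 3(R + 1) > n + 1, the lower end because `G` has the factor 1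
      -- - z and z = 1 at r = 0.
      ≈⟨ +-cong (-‿cong (trans (*-congˡ (trans (*-congˡ (I-vanish {suc n} {suc R} n<3R)) (zeroʳ _))) (zeroʳ _)))
                (-‿cong (-‿cong (*-congʳ (*-congʳ (*-congʳ (*-congʳ (*-congʳ (*-congˡ (-‿inverseʳ 1#))))))))) ⟩
    - 0# - (- (N * 0# * (1# - a * N * q * 1#) * (1# - a * N * 1#) * (q - a * N * 1#) * 1# * (H 0 * I (suc n) 0)))
      ≈⟨ solve 5 (λ N u v w x →
          :- :0 :- (:- (N :* :0 :* u :* v :* w :* :1 :* x))
          := :0)
          refl N (1# - a * N * q * 1#) (1# - a * N * 1#) (q - a * N * 1#) (H 0 * I (suc n) 0) ⟩
    0#  ∎)
    where
    N = pow q n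
    k = 1# - a * (N * N * N)
    n<3R : suc n < suc R ℕ.* 3
    n<3R = s≤s (s≤s (ℕ.m≤n⇒m≤1+n (ℕ.≤-trans n≤R (ℕ.m≤m*n R 3))))

  S-zero : ∀ g R → S g R 0 ≈ g 0
  S-zero g zero    = trans (*-congˡ (trans (*-cong 1⁻¹≈1 1⁻¹≈1) (*-identityˡ _))) (*-identityʳ _)
  S-zero g (suc R) = trans
    (+-cong (S-zero g R) (trans (*-congˡ (I-vanish {0} {suc R} (s≤s z≤n))) (zeroʳ _))) (+-identityʳ _)

  -- This is β_n of (i) without its factor K; with aq for a it serves (ii), and (iii) up to qⁿ.
  B : ℕ → Carrier
  B n = poch a p n ÷ (poch a q (2 ℕ.* n) * poch q q n)

  pow-2* : ∀ n → pow q (2 ℕ.* n) ≈ pow q n * pow q n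
  pow-2* n = trans (pow-+ q n (n ℕ.+ 0)) (*-congˡ (reflexive (≡.cong (pow q) (ℕ.+-identityʳ n))))

  poch-2* : ∀ n → let N = pow q n in
    poch a q (2 ℕ.* suc n) ≈ poch a q (2 ℕ.* n) * (1# - a * (N * N)) * (1# - a * (q * (N * N)))
  poch-2* n = trans (reflexive (≡.cong (poch a q) (≡.cong suc (ℕ.+-suc n (n ℕ.+ 0)))))
    (*-cong (*-congˡ (fac (pow-2* n))) (fac (*-congˡ (pow-2* n))))
    where
    fac : ∀ {x y} → x ≈ y → 1# - a * x ≈ 1# - a * y
    fac h = +-congˡ (-‿cong (*-congˡ h))

  Bden≉0 : ∀ n → poch a q (2 ℕ.* n) * poch q q n ≉0
  Bden≉0 n = *-≉0 (aq≉0 (2 ℕ.* n)) (qq≉0 n)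

  Bden-next : ∀ n → poch a q (2 ℕ.* suc n) * poch q q (suc n) ≈
    poch a q (2 ℕ.* n) * poch q q n * D (pow q n)
  Bden-next n = trans (*-congʳ (poch-2* n))
    (solve 5 (λ P Q a q N →
        P :* (:1 :- a :* (N :* N)) :* (:1 :- a :* (q :* (N :* N))) :* (Q :* (:1 :- q :* N))
        := P :* Q :* ((:1 :- a :* (N :* N)) :* (:1 :- a :* (N :* N) :* q) :* (:1 :- N :* q)))
        refl (poch a q (2 ℕ.* n)) (poch q q n) a q (pow q n))

  D≉0 : ∀ n → D (pow q n) ≉0
  D≉0 n = x*y≉0⇒y≉0 (≉0-resp (Bden-next n) (Bden≉0 (suc n)))

  B-rec : ∀ n → let N = pow q n in D N * B (suc n) ≈ (1# - a * (N * N * N)) * B n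
  B-rec n = x*y≈k*z⇒k*[z÷x]≈y (Bden≉0 (suc n)) (begin
    poch a q (2 ℕ.* suc n) * poch q q (suc n) * (k * (poch a p n * d ⁻¹))
      ≈⟨ *-congʳ (Bden-next n) ⟩
    d * D N * (k * (poch a p n * d ⁻¹))
      ≈⟨ solve 5 (λ d e k P i →
          d :* e :* (k :* (P :* i))
          := (d :* i) :* (e :* (P :* k)))
          refl d (D N) k (poch a p n) (d ⁻¹) ⟩
    (d * d ⁻¹) * (D N * (poch a p n * k))
      ≈⟨ *-cong (⁻¹-inverse d (Bden≉0 n)) (*-congˡ (*-congˡ (+-congˡ (-‿cong (*-congˡ (sym (pow-p-cube n))))))) ⟩
    1# * (D N * poch a p (suc n))
      ≈⟨ *-identityˡ _ ⟩
    D N * poch a p (suc n)  ∎)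
    where
    N = pow q n
    k = 1# - a * (N * N * N)
    d = poch a q (2 ℕ.* n) * poch q q n

  -- Both sides satisfy the same first-order recurrence in n, by `S-rec` and `B-rec`. The factor 1 -
  -- a is `f 0`, as `f` omits the normalising denominator 1 - a.
  S-closed : ∀ n R → n ≤ R → S f R n ≈ (1# - a) * B n
  S-closed zero R _ = begin
    S f R 0                                                     ≈⟨ S-zero f R ⟩
    (1# - a * (1# * 1#)) * (1# * 1# ⁻¹ * 1# * 1#)               ≈⟨ *-congˡ (*-congʳ (*-congʳ (*-congˡ 1⁻¹≈1))) ⟩
    (1# - a * (1# * 1#)) * (1# * 1# * 1# * 1#)
      ≈⟨ solve 1 (λ a →
          (:1 :- a :* (:1 :* :1)) :* (:1 :* :1 :* :1 :* :1)
          := (:1 :- a) :* (:1 :* :1))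
          refl a ⟩
    (1# - a) * (1# * 1#)                                        ≈⟨ *-congˡ (*-congˡ (trans (⁻¹-cong (*-identityˡ _)) 1⁻¹≈1)) ⟨
    (1# - a) * B 0                                              ∎
  S-closed (suc n) R n<R = *-cancelˡ-≉0 (D≉0 n) (begin
    D N * S f R (suc n)       ≈⟨ S-rec n≤R ⟩
    k * S f R n               ≈⟨ *-congˡ (S-closed n R n≤R) ⟩
    k * ((1# - a) * B n)      ≈⟨ solve 3 (λ k x y →
        k :* (x :* y)
        := x :* (k :* y))
        refl k (1# - a) (B n) ⟩
    (1# - a) * (k * B n)      ≈⟨ *-congˡ (B-rec n) ⟨
    (1# - a) * (D N * B (suc n))  ≈⟨ solve 3 (λ k x y →
        x :* (k :* y)
        := k :* (x :* y))
        refl (D N) (1# - a) (B (suc n)) ⟩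
    D N * ((1# - a) * B (suc n))  ∎)
    where
    N = pow q n
    k = 1# - a * (N * N * N)
    n≤R : n ≤ R
    n≤R = ℕ.<⇒≤ n<R

-- Polynomial identities linking K to the moments of x_r

module KPolynomial {c ℓ} (F : Field c ℓ) where
  open FieldLemmas F

  module _ {n} (a b c′ d e u v p : Polynomial n) where
    private
      σ₁ = b :+ c′ :+ d :+ e
      σ₂ = b :* c′ :+ b :* d :+ b :* e :+ c′ :* d :+ c′ :* e :+ d :* e
      σ₃ = b :* c′ :* d :+ b :* c′ :* e :+ b :* d :* e :+ c′ :* d :* e
      σ₄ = b :* c′ :* d :* e
      a² = a :* a

    -- A syntactic copy whose evaluation unfolds to `Knum` itself, which opens it to the solver and
    -- to `⟦⟧-cong`.
    :Knum : Polynomial n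
    :Knum =
         u :* v :* (σ₃ :- a :* σ₁) :* (p :* σ₃ :- a :* σ₁) :* a²
      :+ (:1 :- p) :* u :* v :* (a² :- σ₄) :* (a² :- σ₂ :* a :+ σ₄) :* a
      :+ (u :+ v) :* (a :+ u :* v) :* (σ₃ :- a :* σ₁) :* (a² :- p :* σ₄) :* a
      :+ (u :* u :+ a) :* (v :* v :+ a) :* (a² :- σ₄) :* (a² :- p :* σ₄)

    :Kden : Polynomial n
    :Kden = (a² :- b :* c′ :* d :* e) :* (a² :- b :* c′ :* d :* e :* p)
            :* (:1 :- u) :* (a :- u) :* (:1 :- v) :* (a :- v)

    -- For e = a the first two terms of `Knum` share the factor u v a², since a² - σ₄ = a(a - bcd);
    -- `:P` is what remains of them. `:M` is the corresponding part of the third term.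
    :M :P : Polynomial n
    :M = σ₃ :- a :* σ₁
    :P = (σ₃ :- a :* σ₁) :* (p :* σ₃ :- a :* σ₁)
         :- (:1 :- p) :* (b :* c′ :* d :- a) :* (a² :- σ₂ :* a :+ σ₄)

  module _ {a b b′ c′ c″ d d′ u v p : Carrier} (b≈ : b ≈ b′) (c≈ : c′ ≈ c″) (d≈ : d ≈ d′) where
    private
      -- Variable 0 fills the slots of both a and e, as K occurs only with e = a.
      congruence : (e : ∀ {n} → (a b c d e u v p : Polynomial n) → Polynomial n) →
        let k = e (var (# 0)) (var (# 1)) (var (# 2)) (var (# 3)) (var (# 0)) (var (# 4)) (var (# 5)) (var (# 6)) in
        ⟦ k ⟧ (a ∷ b ∷ c′ ∷ d ∷ u ∷ v ∷ p ∷ []) ≈ ⟦ k ⟧ (a ∷ b′ ∷ c″ ∷ d′ ∷ u ∷ v ∷ p ∷ [])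
      congruence e = ⟦⟧-cong (e (var (# 0)) (var (# 1)) (var (# 2)) (var (# 3)) (var (# 0)) (var (# 4)) (var (# 5)) (var (# 6)))
        λ { zero → refl ; (suc zero) → b≈ ; (suc (suc zero)) → c≈ ; (suc (suc (suc zero))) → d≈
          ; (suc (suc (suc (suc i)))) → refl }

    Knum-cong : Knum a b c′ d a u v p ≈ Knum a b′ c″ d′ a u v p
    Knum-cong = congruence :Knum

    Kden-cong : Kden a b c′ d a u v p ≈ Kden a b′ c″ d′ a u v p
    Kden-cong = congruence :Kden

  -- At b, c, d, e = i, qi, q²i, a with i = q⁻ⁿ and p = q³ one has a² − σ₄ = −a E(i), a² − pσ₄ = −a E(qi) and
  -- b_{n−1}/b_n = Δ(i)/(i² E(i)); the first two moments of x_r are M(i)/E(i) and P(i)/(E(i) E(qi)) times b_n.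
  module _ (a q : Carrier) where
    E Δ M P : Carrier → Carrier
    E i = q * q * q * (i * i * i) - a
    Δ i = (q * q * (i * i) - a) * (q * (i * i) - a) * (i - 1#)
    M i = let b = i; c′ = q * 1# * i; d = q * (q * 1#) * i in
      (b * c′ * d + b * c′ * a + b * d * a + c′ * d * a) - a * (b + c′ + d + a)
    P i = let b = i; c′ = q * 1# * i; d = q * (q * 1#) * i; p = pow q 3
              σ₁ = b + c′ + d + a
              σ₂ = b * c′ + b * d + b * a + c′ * d + c′ * a + d * a
              σ₃ = b * c′ * d + b * c′ * a + b * d * a + c′ * d * a
              σ₄ = b * c′ * d * a in
      (σ₃ - a * σ₁) * (p * σ₃ - a * σ₁) - (1# - p) * (b * c′ * d - a) * (a * a - σ₂ * a + σ₄)

    module _ {i b₀ b₁ s₁ : Carrier} (i≉0 : i ≉0)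
             (row  : i * i * b₁ ≈ (i * i + a) * b₀ - i * s₁)
             (step : i * i * E i * b₁ ≈ Δ i * b₀) where

      -- Multiplying `row` by E(i) and substituting `step` gives i E(i) s₁ = (E(i)(i² + a) - Δ(i))
      -- b₀; the bracket has no constant term in i and equals i M(i).
      first-moment : E i * s₁ ≈ M i * b₀
      first-moment = *-cancelˡ-≉0 i≉0
        (modulo (E i) row (modulo (- 1#) step (trans
          (solve 7 (λ i e d a b₀ b₁ s₁ →
              i :* (e :* s₁)
              := (e :* (i :* i :+ a) :- d) :* b₀ :+ e :* (i :* i :* b₁ :- ((i :* i :+ a) :* b₀ :- i
                 :* s₁)) :+ (:- :1) :* (i :* i :* e :* b₁ :- d :* b₀))
              refl i (E i) (Δ i) a b₀ b₁ s₁)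
          (+-congʳ (+-congʳ
            (solve 4 (λ i a q b₀ →
                ((q :* q :* q :* (i :* i :* i) :- a) :* (i :* i :+ a) :- (q :* q :* (i :* i) :- a)
                :* (q :* (i :* i) :- a) :* (i :- :1)) :* b₀
                := i :* (:M a i (q :* :1 :* i) (q :* (q :* :1) :* i) a a a a :* b₀))
                refl i a q b₀))))))

      module _ {b₂ s₁′ s₂ : Carrier} (q≉0 : q ≉0)
               (row′  : i * i * s₁′ ≈ (i * i + a) * s₁ - i * s₂)
               (row″  : q * i * (q * i) * b₂ ≈ (q * i * (q * i) + a) * b₁ - q * i * s₁′)
               (step′ : q * i * (q * i) * E (q * i) * b₂ ≈ Δ (q * i) * b₁) where
        private
          j = q * i

        -- The left side is the coefficient of b₀ left after `second-moment` has eliminated b₁, b₂,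
        -- s₁ and s₁′.
        second-moment-identity : j * (i * i + a) * E j * M i + Δ i * Δ j - Δ i * E j * (j * j + a)
          ≈ q * (i * i) * P i
        second-moment-identity =
          solve 3 (λ a q i →
              q :* i :* (i :* i :+ a) :* (q :* q :* q :* (q :* i :* (q :* i) :* (q :* i)) :- a) :*
              :M a i (q :* :1 :* i) (q :* (q :* :1) :* i) a a a a :+ (q :* q :* (i :* i) :- a) :* (q
              :* (i :* i) :- a) :* (i :- :1) :* ((q :* q :* (q :* i :* (q :* i)) :- a) :* (q :* (q
              :* i :* (q :* i)) :- a) :* (q :* i :- :1)) :- (q :* q :* (i :* i) :- a) :* (q :* (i :*
              i) :- a) :* (i :- :1) :* (q :* q :* q :* (q :* i :* (q :* i) :* (q :* i)) :- a) :* (q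
              :* i :* (q :* i) :+ a)
              := q :* (i :* i) :* :P a i (q :* :1 :* i) (q :* (q :* :1) :* i) a a a (q :* (q :* (q
                 :* :1))))
              refl a q i

        -- `row′` trades s₂ for s₁ and s₁′, and `row″` trades s₁′ for b₁ and b₂; the first moment
        -- and the two steps then bring everything back to b₀. Each `modulo` carries the multiple in
        -- which its relation enters.
        second-moment : E i * E j * s₂ ≈ P i * b₀
        second-moment = *-cancelˡ-≉0 (*-≉0 q≉0 (*-≉0 i≉0 i≉0))
          (modulo (q * i * E i * E j) row′
          (modulo (- (i * i * E i * E j)) row″
          (modulo (j * (i * i + a) * E j) first-moment
          (modulo (i * i * E i) step′
          (modulo (Δ j - E j * (j * j + a)) step
          (trans
            (solve 14 (λ i q a e₁ e₂ d₁ d₂ m b₀ b₁ b₂ s₁ s₁′ s₂ →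
                q :* (i :* i) :* (e₁ :* e₂ :* s₂)
                := (q :* i :* (i :* i :+ a) :* e₂ :* m :+ d₁ :* d₂ :- d₁ :* e₂ :* (q :* i :* (q :*
                   i) :+ a)) :* b₀ :+ q :* i :* e₁ :* e₂ :* (i :* i :* s₁′ :- ((i :* i :+ a) :* s₁
                   :- i :* s₂)) :+ (:- (i :* i :* e₁ :* e₂)) :* (q :* i :* (q :* i) :* b₂ :- ((q :*
                   i :* (q :* i) :+ a) :* b₁ :- q :* i :* s₁′)) :+ q :* i :* (i :* i :+ a) :* e₂ :*
                   (e₁ :* s₁ :- m :* b₀) :+ i :* i :* e₁ :* (q :* i :* (q :* i) :* e₂ :* b₂ :- d₂ :*
                   b₁) :+ (d₂ :- e₂ :* (q :* i :* (q :* i) :+ a)) :* (i :* i :* e₁ :* b₁ :- d₁ :*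
                   b₀))
                refl i q a (E i) (E j) (Δ i) (Δ j) (M i) b₀ b₁ b₂ s₁ s₁′ s₂)
            (+-congʳ (+-congʳ (+-congʳ (+-congʳ (+-congʳ
              (trans (*-congʳ second-moment-identity) (*-assoc _ _ _)))))))))))))

    module _ {i u u⁻ v v⁻ b₀ s₁ s₂ : Carrier} (uu⁻≈1 : u * u⁻ ≈ 1#) (vv⁻≈1 : v * v⁻ ≈ 1#)
             (moment₁ : E i * s₁ ≈ M i * b₀) (moment₂ : E i * E (q * i) * s₂ ≈ P i * b₀) where
      private
        Kn = Knum a i (q * 1# * i) (q * (q * 1#) * i) a u v (pow q 3)
        Kd = Kden a i (q * 1# * i) (q * (q * 1#) * i) a u v (pow q 3)
        e₁ = E i
        e₂ = E (q * i)
        κ = (1# - u) * (1# - a * u⁻) * ((1# - v) * (1# - a * v⁻))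
        s = u + a * u⁻
        t = v + a * v⁻
        Σ = s₂ - (s + t) * s₁ + s * t * b₀

        us≈ : u * s ≈ u * u + a
        us≈ = modulo a uu⁻≈1 (solve 3 (λ u u⁻ a →
            u :* (u :+ a :* u⁻)
            := u :* u :+ a :+ a :* (u :* u⁻ :- :1))
            refl u u⁻ a)

        vt≈ : v * t ≈ v * v + a
        vt≈ = modulo a vv⁻≈1 (solve 3 (λ v v⁻ a →
            v :* (v :+ a :* v⁻)
            := v :* v :+ a :+ a :* (v :* v⁻ :- :1))
            refl v v⁻ a)

        κuv≈ : u * v * κ ≈ (1# - u) * (u - a) * ((1# - v) * (v - a))
        κuv≈ = begin
          u * v * κ
            ≈⟨ solve 5 (λ u v u⁻ v⁻ a →
                u :* v :* ((:1 :- u) :* (:1 :- a :* u⁻) :* ((:1 :- v) :* (:1 :- a :* v⁻)))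
                := (:1 :- u) :* (u :- a :* (u :* u⁻)) :* ((:1 :- v) :* (v :- a :* (v :* v⁻))))
                refl u v u⁻ v⁻ a ⟩
          (1# - u) * (u - a * (u * u⁻)) * ((1# - v) * (v - a * (v * v⁻)))
            ≈⟨ *-cong (*-congˡ (+-congˡ (-‿cong (trans (*-congˡ uu⁻≈1) (*-identityʳ a)))))
                      (*-congˡ (+-congˡ (-‿cong (trans (*-congˡ vv⁻≈1) (*-identityʳ a))))) ⟩
          (1# - u) * (u - a) * ((1# - v) * (v - a))  ∎

        Kd≈ : Kd ≈ a * a * (e₁ * e₂) * (u * v * κ)
        Kd≈ = trans
          (solve 5 (λ a q i u v →
              :Kden a i (q :* :1 :* i) (q :* (q :* :1) :* i) a u v (q :* (q :* (q :* :1)))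
              := a :* a :* ((q :* q :* q :* (i :* i :* i) :- a) :* (q :* q :* q :* (q :* i :* (q :*
                 i) :* (q :* i)) :- a)) :* ((:1 :- u) :* (u :- a) :* ((:1 :- v) :* (v :- a))))
              refl a q i u v)
          (*-congˡ (sym κuv≈))

        Kn≈ : Kn ≈ a * a * (u * v * P i - (u + v) * (u * v + a) * (e₂ * M i)
                             + (u * u + a) * (v * v + a) * (e₁ * e₂))
        Kn≈ = solve 5 (λ a q i u v →
            :Knum a i (q :* :1 :* i) (q :* (q :* :1) :* i) a u v (q :* (q :* (q :* :1)))
            := a :* a :* (u :* v :* :P a i (q :* :1 :* i) (q :* (q :* :1) :* i) a u v (q :* (q :* (q
               :* :1))) :- (u :+ v) :* (u :* v :+ a) :* ((q :* q :* q :* (q :* i :* (q :* i) :* (q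
               :* i)) :- a) :* :M a i (q :* :1 :* i) (q :* (q :* :1) :* i) a u v a) :+ (u :* u :+ a)
               :* (v :* v :+ a) :* ((q :* q :* q :* (i :* i :* i) :- a) :* (q :* q :* q :* (q :* i
               :* (q :* i) :* (q :* i)) :- a))))
            refl a q i u v

        uvΣ≈ : u * v * Σ ≈ u * v * s₂ - (u + v) * (u * v + a) * s₁ + (u * u + a) * (v * v + a) * b₀
        uvΣ≈ = begin
          u * v * Σ
            ≈⟨ solve 7 (λ u v s t s₁ s₂ b₀ →
                u :* v :* (s₂ :- (s :+ t) :* s₁ :+ s :* t :* b₀)
                := u :* v :* s₂ :- (u :* s :* v :+ u :* (v :* t)) :* s₁ :+ u :* s :* (v :* t) :* b₀)
                refl u v s t s₁ s₂ b₀ ⟩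
          u * v * s₂ - (u * s * v + u * (v * t)) * s₁ + u * s * (v * t) * b₀
            ≈⟨ +-cong (+-congˡ (-‿cong (*-congʳ (+-cong (*-congʳ us≈) (*-congˡ vt≈)))))
                      (*-congʳ (*-cong us≈ vt≈)) ⟩
          u * v * s₂ - ((u * u + a) * v + u * (v * v + a)) * s₁ + (u * u + a) * (v * v + a) * b₀
            ≈⟨ solve 6 (λ u v a s₁ s₂ b₀ →
                u :* v :* s₂ :- ((u :* u :+ a) :* v :+ u :* (v :* v :+ a)) :* s₁ :+ (u :* u :+ a) :*
                (v :* v :+ a) :* b₀
                := u :* v :* s₂ :- (u :+ v) :* (u :* v :+ a) :* s₁ :+ (u :* u :+ a) :* (v :* v :+ a)
                   :* b₀)
                refl u v a s₁ s₂ b₀ ⟩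
          u * v * s₂ - (u + v) * (u * v + a) * s₁ + (u * u + a) * (v * v + a) * b₀  ∎

      -- Multiplication by uv turns s + t into (u + v)(uv + a) and st into (u² + a)(v² + a), the
      -- coefficients in `Knum`. The factor uv comes from the denominator, which equals a² E(i)
      -- E(qi) uvκ.
      Kden*Σ : Kd * Σ ≈ κ * b₀ * Kn
      Kden*Σ = begin
        Kd * Σ
          ≈⟨ *-congʳ Kd≈ ⟩
        a * a * (e₁ * e₂) * (u * v * κ) * Σ
          ≈⟨ solve 6 (λ a e u v k x →
              a :* a :* e :* (u :* v :* k) :* x
              := k :* (a :* a :* (e :* (u :* v :* x))))
              refl a (e₁ * e₂) u v κ Σ ⟩
        κ * (a * a * (e₁ * e₂ * (u * v * Σ)))
          ≈⟨ *-congˡ (*-congˡ (*-congˡ uvΣ≈)) ⟩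
        κ * (a * a * (e₁ * e₂ * (u * v * s₂ - w * s₁ + x * b₀)))
          ≈⟨ *-congˡ (*-congˡ (solve 9 (λ e₁ e₂ u v w x s₁ s₂ b₀ →
              e₁ :* e₂ :* (u :* v :* s₂ :- w :* s₁ :+ x :* b₀)
              := u :* v :* (e₁ :* e₂ :* s₂) :- w :* (e₂ :* (e₁ :* s₁)) :+ x :* (e₁ :* e₂) :* b₀)
              refl e₁ e₂ u v w x s₁ s₂ b₀)) ⟩
        κ * (a * a * (u * v * (e₁ * e₂ * s₂) - w * (e₂ * (e₁ * s₁)) + x * (e₁ * e₂) * b₀))
          ≈⟨ *-congˡ (*-congˡ (+-congʳ (+-cong (*-congˡ moment₂) (-‿cong (*-congˡ (*-congˡ moment₁)))))) ⟩
        κ * (a * a * (u * v * (P i * b₀) - w * (e₂ * (M i * b₀)) + x * (e₁ * e₂) * b₀))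
          ≈⟨ solve 11 (λ k a u v w x P M e₂ e b₀ →
              k :* (a :* a :* (u :* v :* (P :* b₀) :- w :* (e₂ :* (M :* b₀)) :+ x :* e :* b₀))
              := k :* b₀ :* (a :* a :* (u :* v :* P :- w :* (e₂ :* M) :+ x :* e)))
              refl κ a u v w x (P i) (M i) e₂ (e₁ * e₂) b₀ ⟩
        κ * b₀ * (a * a * (u * v * P i - w * (e₂ * M i) + x * (e₁ * e₂)))
          ≈⟨ *-congˡ Kn≈ ⟨
        κ * b₀ * Kn  ∎
        where
        w = (u + v) * (u * v + a)
        x = (u * u + a) * (v * v + a)

-- Moments of x_r and the weighted sum

module WeightedSum {c ℓ} (F : Field c ℓ) (q : Field.Carrier F)
                   (nonvanishing : FieldLemmas.Nonvanishing F q) (a : Field.Carrier F)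
                   (nonvanishingAt : FieldLemmas.NonvanishingAt F q a) where
  open FieldLemmas F
  open Base F q nonvanishing
  open Summation F q nonvanishing a nonvanishingAt public
  open KPolynomial F

  X : ℕ → Carrier
  X r = z⁻ r + a * z r

  private
    E′ Δ′ M′ P′ : Carrier → Carrier
    E′ = E a q
    Δ′ = Δ a q
    M′ = M a q
    P′ = P a q

  -- This is `I-row` multiplied by j²/z, where j stands for the inverse of qⁿ⁺¹, the power in which
  -- K is written. Only the relation for j is assumed, because j is later also q * i, which is not
  -- syntactically a power.
  I-row-X : ∀ n r j → q * pow q n * j ≈ 1# → j * j * I n r ≈ (j * j + a - j * X r) * I (suc n) r
  I-row-X n r j qNj≈1 = trans (*-congˡ (I-row′ n r))
    (modulo ((j * j - a * j * Z * (q * N * j) + a * (q * N * j) * (q * N * j)) * x) (zz⁻≈1 r)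
    (modulo ((a * (q * N * j) + a - a * j * Z - j * Z⁻) * x) qNj≈1
      (solve 7 (λ N q a j Z Z⁻ x →
          j :* j :* (Z⁻ :* ((Z :- q :* N) :* (:1 :- a :* N :* q :* Z) :* x))
          := (j :* j :+ a :- j :* (Z⁻ :+ a :* Z)) :* x :+ (j :* j :- a :* j :* Z :* (q :* N :* j) :+
             a :* (q :* N :* j) :* (q :* N :* j)) :* x :* (Z :* Z⁻ :- :1) :+ (a :* (q :* N :* j) :+
             a :- a :* j :* Z :- j :* Z⁻) :* x :* (q :* N :* j :- :1))
          refl N q a j Z Z⁻ x)))
    where
    N = pow q n
    Z = z r
    Z⁻ = z⁻ r
    x = I (suc n) r

  -- The weight stays arbitrary: `f` leads to the first moment and `fX` to the second.
  S-row : ∀ n R g j → q * pow q n * j ≈ 1# →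
    j * j * S g R n ≈ (j * j + a) * S g R (suc n) - j * S (λ r → g r * X r) R (suc n)
  S-row n R g j qNj≈1 = begin
    j * j * S g R n
      ≈⟨ sumTo-* _ _ R ⟨
    sumTo (λ r → j * j * (g r * I n r)) R
      ≈⟨ sumTo-cong R (λ r _ → term r) ⟩
    sumTo (λ r → (j * j + a) * (g r * I (suc n) r) + (- j) * (g r * X r * I (suc n) r)) R
      ≈⟨ sumTo-+ _ _ R ⟩
    sumTo (λ r → (j * j + a) * (g r * I (suc n) r)) R + sumTo (λ r → (- j) * (g r * X r * I (suc n) r)) R
      ≈⟨ +-cong (sumTo-* _ _ R) (sumTo-* _ _ R) ⟩
    (j * j + a) * S g R (suc n) + (- j) * S (λ r → g r * X r) R (suc n)
      ≈⟨ solve 4 (λ k s j t →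
          k :* s :+ (:- j) :* t
          := k :* s :- j :* t)
          refl (j * j + a) (S g R (suc n)) j (S (λ r → g r * X r) R (suc n)) ⟩
    (j * j + a) * S g R (suc n) - j * S (λ r → g r * X r) R (suc n)  ∎
    where
    term : ∀ r → j * j * (g r * I n r) ≈ (j * j + a) * (g r * I (suc n) r) + (- j) * (g r * X r * I (suc n) r)
    term r = begin
      j * j * (g r * I n r)                                ≈⟨ solve 3 (λ j g x →
          j :* j :* (g :* x)
          := g :* (j :* j :* x))
          refl j (g r) (I n r) ⟩
      g r * (j * j * I n r)                                ≈⟨ *-congˡ (I-row-X n r j qNj≈1) ⟩
      g r * ((j * j + a - j * X r) * I (suc n) r)
        ≈⟨ solve 5 (λ g j a X x →
            g :* ((j :* j :+ a :- j :* X) :* x)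
            := (j :* j :+ a) :* (g :* x) :+ (:- j) :* (g :* X :* x))
            refl (g r) j a (X r) (I (suc n) r) ⟩
      (j * j + a) * (g r * I (suc n) r) + (- j) * (g r * X r * I (suc n) r)  ∎

  -- `S-rec` multiplied by q³i⁵: since q N i = 1, its coefficients in N become E and Δ in i.
  S-step : ∀ {n R} i → n ≤ R → q * pow q n * i ≈ 1# → i * i * E′ i * S f R n ≈ Δ′ i * S f R (suc n)
  S-step {n} {R} i n≤R e≈1 = begin
    i * i * E′ i * S f R n
      ≈⟨ *-congʳ (*-congˡ (+-congˡ (-‿cong a≈ae³))) ⟩
    i * i * (q * q * q * (i * i * i) - a * (e * e * e)) * S f R n
      ≈⟨ solve 5 (λ a q i N s →
          i :* i :* (q :* q :* q :* (i :* i :* i) :- a :* (q :* N :* i :* (q :* N :* i) :* (q :* N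
          :* i))) :* s
          := q :* q :* q :* (i :* i :* i :* i :* i) :* ((:1 :- a :* (N :* N :* N)) :* s))
          refl a q i N (S f R n) ⟩
    q * q * q * (i * i * i * i * i) * ((1# - a * (N * N * N)) * S f R n)
      ≈⟨ *-congˡ (S-rec n≤R) ⟨
    q * q * q * (i * i * i * i * i) * (D N * S f R (suc n))
      ≈⟨ solve 5 (λ a q i N s →
          q :* q :* q :* (i :* i :* i :* i :* i) :* ((:1 :- a :* (N :* N)) :* (:1 :- a :* (N :* N)
          :* q) :* (:1 :- N :* q) :* s)
          := (q :* q :* (i :* i) :- a :* (q :* N :* i :* (q :* N :* i))) :* (q :* (i :* i) :- a :*
             (q :* N :* i :* (q :* N :* i))) :* (i :- q :* N :* i) :* s)
          refl a q i N (S f R (suc n)) ⟩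
    (q * q * (i * i) - a * (e * e)) * (q * (i * i) - a * (e * e)) * (i - e) * S f R (suc n)
      ≈⟨ *-congʳ (*-cong (*-cong (+-congˡ (-‿cong ae²≈a)) (+-congˡ (-‿cong ae²≈a))) (+-congˡ (-‿cong e≈1))) ⟩
    Δ′ i * S f R (suc n)  ∎
    where
    N = pow q n
    e = q * N * i
    ae²≈a : a * (e * e) ≈ a
    ae²≈a = trans (*-congˡ (trans (*-cong e≈1 e≈1) (*-identityˡ 1#))) (*-identityʳ a)
    a≈ae³ : a ≈ a * (e * e * e)
    a≈ae³ = sym (trans (*-congˡ (trans (*-congˡ e≈1) (*-identityʳ _))) ae²≈a)

  fX fXX : ℕ → Carrier
  fX r = f r * X r
  fXX r = fX r * X r

  module Moments (m R : ℕ) (m<R : suc m ≤ R) where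
    i j b₀ b₁ s₁ s₁′ s₂ : Carrier
    i = pow q⁻ (suc m)
    j = q * i
    b₀ = S f R (suc m)
    b₁ = S f R m
    s₁ = S fX R (suc m)
    s₁′ = S fX R m
    s₂ = S fXX R (suc m)

    private
      qNi≈1 : q * pow q m * i ≈ 1#
      qNi≈1 = pow-inverse (suc m) qq⁻≈1

      i≉0 : i ≉0
      i≉0 = x*y≉0⇒y≉0 λ h → 0≉1 (trans (sym h) qNi≈1)

      row : i * i * b₁ ≈ (i * i + a) * b₀ - i * s₁
      row = S-row m R f i qNi≈1

      row′ : i * i * s₁′ ≈ (i * i + a) * s₁ - i * s₂
      row′ = S-row m R fX i qNi≈1

      step : i * i * E′ i * b₁ ≈ Δ′ i * b₀
      step = S-step i (ℕ.<⇒≤ m<R) qNi≈1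

    SecondMoment : Set ℓ
    SecondMoment = E′ i * E′ j * s₂ ≈ P′ i * b₀

    moment₁ : E′ i * s₁ ≈ M′ i * b₀
    moment₁ = first-moment a q i≉0 row step

    moment₂-from : ∀ b₂ → j * j * b₂ ≈ (j * j + a) * b₁ - j * s₁′ → j * j * E′ j * b₂ ≈ Δ′ j * b₁ →
      SecondMoment
    moment₂-from b₂ row″ step′ = second-moment a q i≉0 row step q≉0 row′ row″ step′

  moment₂ : ∀ m R (m<R : suc m ≤ R) → Moments.SecondMoment m R m<R
  moment₂ (suc k) R m<R = moment₂-from (S f R k) (S-row k R f j qNj≈1) (S-step j (ℕ.<⇒≤ (ℕ.<⇒≤ m<R)) qNj≈1)
    where
    open Moments (suc k) R m<R
    qNj≈1 : q * pow q k * j ≈ 1#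
    qNj≈1 = trans (solve 3 (λ q N i → q :* N :* (q :* i) := q :* (q :* N) :* i) refl q (pow q k) i) (pow-inverse (2 ℕ.+ k) qq⁻≈1)
  -- The sum for n = −1 is empty, so b₂ = 0.
  moment₂ zero R m<R = moment₂-from 0# (sym (begin
      (j * j + a) * b₁ - j * s₁′
        ≈⟨ +-cong (*-cong (+-congʳ (*-cong j≈1 j≈1)) (S-zero f R)) (-‿cong (*-cong j≈1 (S-zero fX R))) ⟩
      (1# * 1# + a) * f 0 - 1# * (f 0 * (1# + a * 1#))
        ≈⟨ solve 3 (λ j a x →
            (:1 :* :1 :+ a) :* x :- :1 :* (x :* (:1 :+ a :* :1))
            := j :* j :* :0)
            refl j a (f 0) ⟩
      j * j * 0#  ∎))
    (begin
      j * j * E′ j * 0#             ≈⟨ zeroʳ _ ⟩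
      0#                            ≈⟨ zeroˡ _ ⟨
      0# * b₁                       ≈⟨ *-congʳ (zeroʳ _) ⟨
      (q * q * (j * j) - a) * (q * (j * j) - a) * 0# * b₁
                                    ≈⟨ *-congʳ (*-congˡ (trans (+-congʳ j≈1) (-‿inverseʳ 1#))) ⟨
      Δ′ j * b₁                     ∎)
    where
    open Moments zero R m<R
    j≈1 : j ≈ 1#
    j≈1 = trans (*-congˡ (*-identityʳ q⁻)) qq⁻≈1

  module Weight (u v : Carrier) (u≉0 : u ≉0) (v≉0 : v ≉0) where
    -- Since `X 0` is 1 + a, κ is the weight (X - s)(X - t) at r = 0. Dividing by it makes α₀ = 1,
    -- and uvκ is the factor (1 - u)(a - u)(1 - v)(a - v) of `Kden`.
    κ s t : Carrier
    κ = (1# - u) * (1# - a * u ⁻¹) * ((1# - v) * (1# - a * v ⁻¹))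
    s = u + a * u ⁻¹
    t = v + a * v ⁻¹

    g : ℕ → Carrier
    g r = f r * ((X r - s) * (X r - t))

    S-g : ∀ R n → S g R n ≈ S fXX R n - (s + t) * S fX R n + s * t * S f R n
    S-g R n = begin
      S g R n
        ≈⟨ sumTo-cong R (λ r _ → solve 5 (λ f X s t x →
            f :* ((X :- s) :* (X :- t)) :* x
            := f :* X :* X :* x :+ (:- (s :+ t)) :* (f :* X :* x) :+ s :* t :* (f :* x))
            refl (f r) (X r) s t (I n r)) ⟩
      sumTo (λ r → fXX r * I n r + (- (s + t)) * (fX r * I n r) + s * t * (f r * I n r)) R
        ≈⟨ trans (sumTo-+ _ _ R) (+-congʳ (sumTo-+ _ _ R)) ⟩
      S fXX R n + sumTo (λ r → (- (s + t)) * (fX r * I n r)) R + sumTo (λ r → s * t * (f r * I n r)) R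
        ≈⟨ +-cong (+-congˡ (sumTo-* _ _ R)) (sumTo-* _ _ R) ⟩
      S fXX R n + (- (s + t)) * S fX R n + s * t * S f R n
        ≈⟨ solve 4 (λ x k y w →
            x :+ (:- k) :* y :+ w
            := x :- k :* y :+ w)
            refl (S fXX R n) (s + t) (S fX R n) (s * t * S f R n) ⟩
      S fXX R n - (s + t) * S fX R n + s * t * S f R n  ∎

    module _ (m : ℕ) where
      private
        n = suc m
        b c′ d : Carrier
        b = zpow q (ℤ.- (ℤ.+ n))
        c′ = zpow q (ℤ.+ 1 ℤ.- ℤ.+ n)
        d = zpow q (ℤ.+ 2 ℤ.- ℤ.+ n)

      S-g-closed : Kden a b c′ d a u v p ≉0 → S g n n ≈ κ * (1# - a) * (K a b c′ d a u v p * B n)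
      S-g-closed Kden≉0 = begin
        S g n n
          ≈⟨ S-g n n ⟩
        Σ
          ≈⟨ x*y≈k*z⇒k*[z÷x]≈y Kden≉0 (begin
               Kden a b c′ d a u v p * Σ         ≈⟨ *-congʳ (Kden-cong refl c≈ d≈) ⟩
               Kden a i (q * 1# * i) (q * (q * 1#) * i) a u v p * Σ
                 ≈⟨ Kden*Σ a q (⁻¹-inverse u u≉0) (⁻¹-inverse v v≉0) moment₁ (moment₂ m n ℕ.≤-refl) ⟩
               κ * b₀ * Knum a i (q * 1# * i) (q * (q * 1#) * i) a u v p
                 ≈⟨ *-congˡ (Knum-cong refl c≈ d≈) ⟨
               κ * b₀ * Knum a b c′ d a u v p    ∎) ⟨
        κ * b₀ * K a b c′ d a u v p
          ≈⟨ *-congʳ (*-congˡ (S-closed n n ℕ.≤-refl)) ⟩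
        κ * ((1# - a) * B n) * K a b c′ d a u v p
          ≈⟨ solve 4 (λ k a B K →
              k :* ((:1 :- a) :* B) :* K
              := k :* (:1 :- a) :* (K :* B))
              refl κ a (B n) (K a b c′ d a u v p) ⟩
        κ * (1# - a) * (K a b c′ d a u v p * B n)  ∎
        where
        open Moments m n ℕ.≤-refl
        Σ = s₂ - (s + t) * s₁ + s * t * b₀
        c≈ : c′ ≈ q * 1# * i
        -- `pow q 1` unfolds to q * 1#, the origin of the unreduced units in M, P and `Kden*Σ`.
        c≈ = zpow-⊖ q≉0 1 n
        d≈ : d ≈ q * (q * 1#) * i
        d≈ = zpow-⊖ q≉0 2 n

-- Pochhammer quotients and sums grouped by residue modulo 3

at-residue : ∀ {ℓ} {X : Set ℓ} (sel : ℕ → ℕ → X) {k} r → k < 3 →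
             sel ((k ℕ.+ r ℕ.* 3) ℕ.% 3) ((k ℕ.+ r ℕ.* 3) ℕ./ 3) ≡ sel k r
at-residue sel {k} r k<3 = ≡.cong₂ sel
  (≡.trans (ℕ.[m+kn]%n≡m%n k r 3) (ℕ.m<n⇒m%n≡m k<3))
  (≡.trans (ℕ.+-distrib-/-∣ʳ k (divides r ≡.refl)) (≡.cong₂ ℕ._+_ (ℕ.m<n⇒m/n≡0 k<3) (ℕ.m*n/n≡m r 3)))

module Coefficients {c ℓ} (F : Field c ℓ) (q : Field.Carrier F)
                    (nonvanishing : FieldLemmas.Nonvanishing F q) (a : Field.Carrier F)
                    (nonvanishingAt : FieldLemmas.NonvanishingAt F q a)
                    (u v : Field.Carrier F) (u≉0 : FieldLemmas._≉0 F u) (v≉0 : FieldLemmas._≉0 F v) where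
  open FieldLemmas F
  open Base F q nonvanishing
  open WeightedSum F q nonvanishing a nonvanishingAt public
  open Weight u v u≉0 v≉0 public

  poch-ratio : ∀ {x y} r → y ≈ x * p → (1# - x) * poch y p r ≈ poch x p r * (1# - x * z r)
  poch-ratio {x} {y} r y≈xp = begin
    (1# - x) * poch y p r                 ≈⟨ *-congˡ (poch-cong p r y≈xp) ⟩
    (1# - x) * poch (x * p) p r           ≈⟨ poch-shift x p r ⟩
    poch x p r * (1# - x * pow p r)       ≈⟨ *-congˡ (+-congˡ (-‿cong (*-congˡ (pow-p r)))) ⟩
    poch x p r * (1# - x * z r)           ∎

  well-poised-factor : ∀ {w w⁻} r → w * w⁻ ≈ 1# →
    (1# - w * z r) * (1# - a * w⁻ * z r) * z⁻ r ≈ X r - (w + a * w⁻)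
  well-poised-factor {w} {w⁻} r ww⁻≈1 =
    modulo (a * z r * (z r * z⁻ r)) ww⁻≈1 (modulo (a * z r - w - a * w⁻) (zz⁻≈1 r)
      (solve 5 (λ w i a Z Z⁻ →
          (:1 :- w :* Z) :* (:1 :- a :* i :* Z) :* Z⁻
          := Z⁻ :+ a :* Z :- (w :+ a :* i) :+ a :* Z :* (Z :* Z⁻) :* (w :* i :- :1) :+ (a :* Z :- w
             :- a :* i) :* (Z :* Z⁻ :- :1))
          refl w w⁻ a (z r) (z⁻ r)))

  module _ (u3≉0 : ∀ m → poch u p m ≉0) (v3≉0 : ∀ m → poch v p m ≉0)
           (au3≉0 : ∀ m → poch (a ÷ u) p m ≉0) (av3≉0 : ∀ m → poch (a ÷ v) p m ≉0) where

    κ≉0 : κ ≉0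
    κ≉0 = *-≉0 (*-≉0 (1-x≉0 u3≉0) (1-x≉0 au3≉0)) (*-≉0 (1-x≉0 v3≉0) (1-x≉0 av3≉0))

    -- Covers the quotient of (i) and, at aq, the quotient `A`. The theorem writes x as aq³/u and as
    -- aq⁴/u respectively, which agree with the required (a/u)p only up to ring laws; hence x and y
    -- stay free.
    quotient : Carrier → Carrier → ℕ → Carrier
    quotient x y r =
      (poch a p r * poch (p * u) p r * poch (p * v) p r * poch x p r * poch y p r)
      ÷ (poch u p r * poch v p r * poch (a ÷ u) p r * poch (a ÷ v) p r * poch p p r)

    quotient-zero : ∀ x y → quotient x y 0 ≈ 1#
    quotient-zero x y = ⁻¹-inverse _ (≉0-resp (solve 1 (λ w →
        :1
        := :1 :* :1 :* :1 :* :1 :* :1)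
        refl 1#) 1≉0)

    -- (pu;p)_r/(u;p)_r collapses to (1 - uz)/(1 - u), and the other three pairs do likewise. The
    -- constants make up κ, and each of the two z⁻ turns a pair of numerators into X - s or X - t.
    quotient-closed : ∀ {x y} r → x ≈ (a ÷ u) * p → y ≈ (a ÷ v) * p →
      κ * (quotient x y r * (z⁻ r * z⁻ r)) ≈ poch a p r * ip r * ((X r - s) * (X r - t))
    quotient-closed {x} {y} r x≈ y≈ = begin
      κ * (quotient x y r * (Z⁻ * Z⁻))
        ≈⟨ *-assoc _ _ _ ⟨
      κ * quotient x y r * (Z⁻ * Z⁻)
        ≈⟨ *-congʳ (x*y≈k*z⇒k*[z÷x]≈y den≉0 cross) ⟩
      poch a p r * ip r * (w u * w (a ÷ u) * (w v * w (a ÷ v))) * (Z⁻ * Z⁻)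
        ≈⟨ solve 6 (λ P α β γ δ i →
            P :* (α :* β :* (γ :* δ)) :* (i :* i)
            := P :* (α :* β :* i :* (γ :* δ :* i)))
            refl (poch a p r * ip r) (w u) (w (a ÷ u)) (w v) (w (a ÷ v)) Z⁻ ⟩
      poch a p r * ip r * (w u * w (a ÷ u) * Z⁻ * (w v * w (a ÷ v) * Z⁻))
        ≈⟨ *-congˡ (*-cong (well-poised-factor r (⁻¹-inverse u u≉0)) (well-poised-factor r (⁻¹-inverse v v≉0))) ⟩
      poch a p r * ip r * ((X r - s) * (X r - t))  ∎
      where
      Z⁻ = z⁻ r
      w : Carrier → Carrier
      w x = 1# - x * z r
      den≉0 : poch u p r * poch v p r * poch (a ÷ u) p r * poch (a ÷ v) p r * poch p p r ≉0
      den≉0 = *-≉0 (*-≉0 (*-≉0 (*-≉0 (u3≉0 r) (v3≉0 r)) (au3≉0 r)) (av3≉0 r)) (p≉0 r)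
      cross : poch u p r * poch v p r * poch (a ÷ u) p r * poch (a ÷ v) p r * poch p p r
              * (poch a p r * ip r * (w u * w (a ÷ u) * (w v * w (a ÷ v))))
              ≈ κ * (poch a p r * poch (p * u) p r * poch (p * v) p r * poch x p r * poch y p r)
      cross = begin
        poch u p r * poch v p r * poch (a ÷ u) p r * poch (a ÷ v) p r * poch p p r
        * (poch a p r * ip r * (w u * w (a ÷ u) * (w v * w (a ÷ v))))
          ≈⟨ solve 11 (λ A B C D E P i α β γ δ →
              A :* B :* C :* D :* E :* (P :* i :* (α :* β :* (γ :* δ)))
              := P :* (E :* i) :* (A :* α) :* (B :* γ) :* (C :* β) :* (D :* δ))
              refl (poch u p r) (poch v p r) (poch (a ÷ u) p r) (poch (a ÷ v) p r) (poch p p r)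
              (poch a p r) (ip r) (w u) (w (a ÷ u)) (w v) (w (a ÷ v)) ⟩
        poch a p r * (poch p p r * ip r) * (poch u p r * w u) * (poch v p r * w v)
        * (poch (a ÷ u) p r * w (a ÷ u)) * (poch (a ÷ v) p r * w (a ÷ v))
          ≈⟨ *-cong (*-cong (*-cong (*-cong (*-congˡ (⁻¹-inverse _ (p≉0 r)))
               (sym (poch-ratio r (*-comm p u)))) (sym (poch-ratio r (*-comm p v))))
               (sym (poch-ratio r x≈))) (sym (poch-ratio r y≈)) ⟩
        poch a p r * 1# * ((1# - u) * poch (p * u) p r) * ((1# - v) * poch (p * v) p r)
        * ((1# - a ÷ u) * poch x p r) * ((1# - a ÷ v) * poch y p r)
          ≈⟨ solve 9 (λ P α β γ δ A B C D →
              P :* :1 :* (α :* A) :* (γ :* B) :* (β :* C) :* (δ :* D)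
              := α :* β :* (γ :* δ) :* (P :* A :* B :* C :* D))
              refl (poch a p r) (1# - u) (1# - a ÷ u) (1# - v) (1# - a ÷ v) (poch (p * u) p r)
              (poch (p * v) p r) (poch x p r) (poch y p r) ⟩
        κ * (poch a p r * poch (p * u) p r * poch (p * v) p r * poch x p r * poch y p r)  ∎

  baileyTerm : (ℕ → Carrier) → ℕ → ℕ → Carrier
  baileyTerm α n j = α j * (iq n j * ia (j ℕ.+ n))

  -- Past n the terms vanish through `iq`, so the sum may run up to 3n + 2, that is over whole
  -- triples with r ≤ n.
  bailey-sum : ∀ α n → sumTo (λ j → α j ÷ (poch q q (n ∸ j) * poch (a * q) q (n ℕ.+ j))) n ≈
    sumTo (λ r → baileyTerm α n (r ℕ.* 3) + baileyTerm α n (1 ℕ.+ r ℕ.* 3) + baileyTerm α n (2 ℕ.+ r ℕ.* 3)) n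
  bailey-sum α n = begin
    sumTo (λ j → α j ÷ (poch q q (n ∸ j) * poch (a * q) q (n ℕ.+ j))) n
      ≈⟨ sumTo-cong n (λ j j≤n → *-congˡ (trans (⁻¹-* (qq≉0 (n ∸ j)) (aqq≉0 (n ℕ.+ j)))
           (*-cong (reflexive (≡.sym (iq-≤ j≤n))) (reflexive (≡.cong ia (ℕ.+-comm n j)))))) ⟩
    sumTo (baileyTerm α n) n
      ≈⟨ sumTo-extend (2 ℕ.+ n ℕ.* 2) n (λ j n<j →
           trans (*-congˡ (trans (*-congʳ (reflexive (iq-> n<j))) (zeroˡ _))) (zeroʳ _)) ⟨
    sumTo (baileyTerm α n) (2 ℕ.+ n ℕ.* 2 ℕ.+ n)
      ≡⟨ ≡.cong (sumTo (baileyTerm α n)) (2+2n+n≡2+3n n) ⟩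
    sumTo (baileyTerm α n) (2 ℕ.+ n ℕ.* 3)
      ≈⟨ sumTo-triples (baileyTerm α n) n ⟩
    sumTo (λ r → baileyTerm α n (r ℕ.* 3) + baileyTerm α n (1 ℕ.+ r ℕ.* 3) + baileyTerm α n (2 ℕ.+ r ℕ.* 3)) n  ∎
    where
    2+2n+n≡2+3n : ∀ n → 2 ℕ.+ n ℕ.* 2 ℕ.+ n ≡ 2 ℕ.+ n ℕ.* 3
    2+2n+n≡2+3n = ℕ-Solver.solve-∀

-- The three Bailey pairs

module BaileyPairs {c ℓ} (F : Field c ℓ) (a u v q : Field.Carrier F)
                   (generic : FieldDefs.Generic F a u v q) where
  open FieldLemmas F
  open FieldDefs F using (A; K₀′; ex; sel₁; sel₂; sel₃; α₁-3r; α₁; β₁; α₂; β₂; α₃; β₃)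
  open FieldDefs.Generic generic

  a′ : Carrier
  a′ = a * q

  nonvanishing : Nonvanishing q
  nonvanishing = record { q≉0 = q≉0 ; qq≉0 = qq≉0 ; p≉0 = q33≉0 }

  nonvanishingAt-a : NonvanishingAt q a
  nonvanishingAt-a = record { aq≉0 = aq≉0 ; aqq≉0 = aqq≉0 }

  -- (aq²;q)_m divides (aq;q)_(m+1), so the genericity assumed at a also permits the summation at
  -- aq.
  a′qq≉0 : ∀ m → poch (a′ * q) q m ≉0
  a′qq≉0 m = x*y≉0⇒y≉0 (≉0-resp (sym (poch-shift a′ q m)) (aqq≉0 (suc m)))

  nonvanishingAt-a′ : NonvanishingAt q a′
  nonvanishingAt-a′ = record { aq≉0 = aqq≉0 ; aqq≉0 = a′qq≉0 }

  open Base F q nonvanishing hiding (q≉0; qq≉0)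
  module P = Coefficients F q nonvanishing a nonvanishingAt-a u v u≉0 v≉0
  module P′ = Coefficients F q nonvanishing a′ nonvanishingAt-a′ u v u≉0 v≉0
  open P using (ia; baileyTerm)

  exponent : ∀ k r m n → 9 ℕ.* r ℕ.* r ℕ.+ n ℕ.* 2 ≡ m ℕ.* 2 ℕ.+ k ℕ.* r →
    zpow q (ex a u v q (ℤ.- (ℤ.+ k)) r) ≈ pow q m * pow q⁻ n
  exponent k r m n h = trans (reflexive (≡.cong (zpow q) (half-⊖ (9 ℕ.* r ℕ.* r) k r m n h))) (zpow-⊖ q≉0 m n)

  private
    Q₁ : ℕ → Carrier
    Q₁ = P.quotient u3≉0 v3≉0 au3≉0 av3≉0 (a * p ÷ u) (a * p ÷ v)

    -- (9r² - 15r)/2 is `T r` - 6r, and -6r is the z⁻² demanded by `quotient-closed`.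
    e₁ : ∀ r → zpow q (ex a u v q (ℤ.- (ℤ.+ 15)) r) ≈ pow q (T r) * (z⁻ r * z⁻ r)
    e₁ r = trans (exponent 15 r (T r) (r ℕ.* 3 ℕ.+ r ℕ.* 3)
        (≡.trans (≡.cong (ℕ._+ (r ℕ.* 3 ℕ.+ r ℕ.* 3) ℕ.* 2) (≡.sym (T-closed r))) (lemma (T r) r)))
      (*-congˡ (pow-+ q⁻ (r ℕ.* 3) (r ℕ.* 3)))
      where
      lemma : ∀ t r → t ℕ.* 2 ℕ.+ 3 ℕ.* r ℕ.+ (r ℕ.* 3 ℕ.+ r ℕ.* 3) ℕ.* 2 ≡ t ℕ.* 2 ℕ.+ 15 ℕ.* r
      lemma = ℕ-Solver.solve-∀

  -- `α₁` is 1 by definition at index 0, while the sum over r needs the general formula there as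
  -- well.
  α₁-3r-zero : α₁-3r a u v q 0 ≈ 1#
  α₁-3r-zero = begin
    ((1# - a * 1#) ÷ (1# - a)) * Q₁ 0 * 1# * 1#
      ≈⟨ *-congʳ (*-congʳ (*-cong (trans (*-congʳ (+-congˡ (-‿cong (*-identityʳ a)))) (⁻¹-inverse _ 1-a≉0))
           (P.quotient-zero u3≉0 v3≉0 au3≉0 av3≉0 (a * p ÷ u) (a * p ÷ v)))) ⟩
    1# * 1# * 1# * 1#
      ≈⟨ solve 1 (λ w → :1 :* :1 :* :1 :* :1 := :1) refl 1# ⟩
    1#  ∎

  α₁-3r-closed : ∀ r → P.κ * (1# - a) * α₁-3r a u v q r ≈ P.g r
  α₁-3r-closed r = begin
    P.κ * (1# - a) * (((1# - a * pow q (6 ℕ.* r)) ÷ (1# - a)) * Q₁ r * zpow q (ex a u v q (ℤ.- (ℤ.+ 15)) r) * pow (- a) r)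
      ≈⟨ *-congˡ (*-congʳ (*-cong (*-congʳ (*-congʳ (+-congˡ (-‿cong (*-congˡ pow-6*))))) (e₁ r))) ⟩
    P.κ * (1# - a) * (((1# - a * (z r * z r)) * (1# - a) ⁻¹) * Q₁ r * (pow q (T r) * (z⁻ r * z⁻ r)) * pow (- a) r)
      ≈⟨ solve 8 (λ k x y i Q t w A →
          k :* x :* ((y :* i) :* Q :* (t :* w) :* A)
          := x :* i :* (y :* A :* t) :* (k :* (Q :* w)))
          refl P.κ (1# - a) (1# - a * (z r * z r)) ((1# - a) ⁻¹) (Q₁ r) (pow q (T r)) (z⁻ r * z⁻ r)
          (pow (- a) r) ⟩
    (1# - a) * (1# - a) ⁻¹ * ((1# - a * (z r * z r)) * pow (- a) r * pow q (T r)) * (P.κ * (Q₁ r * (z⁻ r * z⁻ r)))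
      ≈⟨ *-cong (*-congʳ (⁻¹-inverse _ 1-a≉0)) (P.quotient-closed u3≉0 v3≉0 au3≉0 av3≉0 r
           (solve 3 (λ a p i → a :* p :* i := a :* i :* p) refl a p (u ⁻¹)) (solve 3 (λ a p i →
               a :* p :* i
               := a :* i :* p)
               refl a p (v ⁻¹))) ⟩
    1# * ((1# - a * (z r * z r)) * pow (- a) r * pow q (T r)) * (poch a p r * P.ip r * ((P.X r - P.s) * (P.X r - P.t)))
      ≈⟨ solve 6 (λ y A t P i x →
          :1 :* (y :* A :* t) :* (P :* i :* x)
          := y :* (P :* i :* A :* t) :* x)
          refl (1# - a * (z r * z r)) (pow (- a) r) (pow q (T r)) (poch a p r) (P.ip r)
          ((P.X r - P.s) * (P.X r - P.t)) ⟩
    P.g r  ∎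
    where
    6r≡ : ∀ r → 6 ℕ.* r ≡ r ℕ.* 3 ℕ.+ r ℕ.* 3
    6r≡ = ℕ-Solver.solve-∀
    pow-6* : pow q (6 ℕ.* r) ≈ z r * z r
    pow-6* = trans (reflexive (≡.cong (pow q) (6r≡ r))) (pow-+ q (r ℕ.* 3) (r ℕ.* 3))

  α₁-0 : ∀ r → α₁ a u v q (r ℕ.* 3) ≈ α₁-3r a u v q r
  α₁-0 zero    = sym α₁-3r-zero
  α₁-0 (suc r) = reflexive (at-residue (sel₁ a u v q) (suc r) (s≤s z≤n))

  α₁-1 : ∀ r → α₁ a u v q (1 ℕ.+ r ℕ.* 3) ≈ 0#
  α₁-1 r = reflexive (at-residue (sel₁ a u v q) r (s≤s (s≤s z≤n)))

  α₁-2 : ∀ r → α₁ a u v q (2 ℕ.+ r ℕ.* 3) ≈ 0#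
  α₁-2 r = reflexive (at-residue (sel₁ a u v q) r (s≤s (s≤s (s≤s z≤n))))

  pair₁ : BaileyPair a q (α₁ a u v q) (β₁ a u v q)
  pair₁ = refl , λ
    -- `β₁ 0` is 1 by definition and does not pass through K, whose evaluation starts at n = 1.
    { zero → 1≈1÷[1*1]
    ; n@(suc m) → *-cancelˡ-≉0 (*-≉0 (P.κ≉0 u3≉0 v3≉0 au3≉0 av3≉0) 1-a≉0) (sym (begin
        P.κ * (1# - a) * sumTo (λ j → α₁ a u v q j ÷ (poch q q (n ∸ j) * poch (a * q) q (n ℕ.+ j))) n
          ≈⟨ *-congˡ (P.bailey-sum (α₁ a u v q) n) ⟩
        P.κ * (1# - a) * sumTo (λ r → τ n (r ℕ.* 3) + τ n (1 ℕ.+ r ℕ.* 3) + τ n (2 ℕ.+ r ℕ.* 3)) n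
          ≈⟨ sumTo-* _ _ n ⟨
        sumTo (λ r → P.κ * (1# - a) * (τ n (r ℕ.* 3) + τ n (1 ℕ.+ r ℕ.* 3) + τ n (2 ℕ.+ r ℕ.* 3))) n
          ≈⟨ sumTo-cong n (λ r _ → term n r) ⟩
        P.S P.g n n
          ≈⟨ P.S-g-closed m (K₀den≉0 n) ⟩
        P.κ * (1# - a) * β₁ a u v q n  ∎)) }
    where
    τ : ℕ → ℕ → Carrier
    τ = baileyTerm (α₁ a u v q)
    term : ∀ n r → P.κ * (1# - a) * (τ n (r ℕ.* 3) + τ n (1 ℕ.+ r ℕ.* 3) + τ n (2 ℕ.+ r ℕ.* 3))
                 ≈ P.g r * P.I n r
    term n r = begin
      P.κ * (1# - a) * (τ n (r ℕ.* 3) + τ n (1 ℕ.+ r ℕ.* 3) + τ n (2 ℕ.+ r ℕ.* 3))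
        ≈⟨ *-congˡ (+-cong (+-cong (*-congʳ (α₁-0 r)) (*-congʳ (α₁-1 r))) (*-congʳ (α₁-2 r))) ⟩
      P.κ * (1# - a) * (α₁-3r a u v q r * P.I n r + 0# * x₁ + 0# * x₂)
        ≈⟨ solve 5 (λ k α x y w →
            k :* (α :* x :+ :0 :* y :+ :0 :* w)
            := k :* α :* x)
            refl (P.κ * (1# - a)) (α₁-3r a u v q r) (P.I n r) x₁ x₂ ⟩
      P.κ * (1# - a) * α₁-3r a u v q r * P.I n r
        ≈⟨ *-congʳ (α₁-3r-closed r) ⟩
      P.g r * P.I n r  ∎
      where
      x₁ = iq n (1 ℕ.+ r ℕ.* 3) * ia (1 ℕ.+ r ℕ.* 3 ℕ.+ n)
      x₂ = iq n (2 ℕ.+ r ℕ.* 3) * ia (2 ℕ.+ r ℕ.* 3 ℕ.+ n)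

  -- Pairs (ii) and (iii) through the summation at aq

  C : ℕ → Carrier
  C r = A a u v q r * pow q (T r ℕ.+ r) * pow (- a) r

  private
    Q₂ : ℕ → Carrier
    Q₂ = P′.quotient u3≉0 v3≉0 aqu3≉0 aqv3≉0 (a * pow q 4 ÷ u) (a * pow q 4 ÷ v)

  C-zero : C 0 ≈ 1#
  C-zero = trans (*-congʳ (*-congʳ (P′.quotient-zero u3≉0 v3≉0 aqu3≉0 aqv3≉0 (a * pow q 4 ÷ u) (a * pow q 4 ÷ v)))) (solve 1 (λ w →
      :1 :* :1 :* :1
      := :1)
      refl 1#)

  -- The extra q^r in `C` merges with (-a)^r into (-aq)^r, the power that `H` contains at aq.
  C-closed : ∀ r → P′.κ * (C r * (z⁻ r * z⁻ r)) ≈ P′.H r * ((P′.X r - P′.s) * (P′.X r - P′.t))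
  C-closed r = begin
    P′.κ * (Q₂ r * pow q (T r ℕ.+ r) * pow (- a) r * (z⁻ r * z⁻ r))
      ≈⟨ *-congˡ (*-congʳ (*-congʳ (*-congˡ (pow-+ q (T r) r)))) ⟩
    P′.κ * (Q₂ r * (pow q (T r) * pow q r) * pow (- a) r * (z⁻ r * z⁻ r))
      ≈⟨ solve 6 (λ k Q t x A w →
          k :* (Q :* (t :* x) :* A :* w)
          := A :* x :* t :* (k :* (Q :* w)))
          refl P′.κ (Q₂ r) (pow q (T r)) (pow q r) (pow (- a) r) (z⁻ r * z⁻ r) ⟩
    pow (- a) r * pow q r * pow q (T r) * (P′.κ * (Q₂ r * (z⁻ r * z⁻ r)))
      ≈⟨ *-cong (*-congʳ (trans (sym (pow-* (- a) q r)) (pow-cong r (solve 2 (λ a q →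
          :- a :* q
          := :- (a :* q))
          refl a q))))
           (P′.quotient-closed u3≉0 v3≉0 aqu3≉0 aqv3≉0 r (shift u) (shift v)) ⟩
    pow (- a′) r * pow q (T r) * (poch a′ p r * P′.ip r * ((P′.X r - P′.s) * (P′.X r - P′.t)))
      ≈⟨ solve 5 (λ A t P i x →
          A :* t :* (P :* i :* x)
          := P :* i :* A :* t :* x)
          refl (pow (- a′) r) (pow q (T r)) (poch a′ p r) (P′.ip r)
          ((P′.X r - P′.s) * (P′.X r - P′.t)) ⟩
    P′.H r * ((P′.X r - P′.s) * (P′.X r - P′.t))  ∎
    where
    shift : ∀ w → a * pow q 4 ÷ w ≈ (a * q ÷ w) * p
    shift w = solve 3 (λ a q i →
        a :* (q :* (q :* (q :* (q :* :1)))) :* i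
        := a :* q :* i :* (q :* (q :* (q :* :1))))
        refl a q (w ⁻¹)

  -- Takes the kernel at aq back to the kernel at a with index m + 1; this is the index to which the
  -- terms j = 3r and j = 3r + 1 are both brought.
  ia-shift : ∀ m → P′.ia m ≈ (1# - a′) * ia (suc m)
  ia-shift m = *-cancelˡ-≉0 (a′qq≉0 m) (begin
    poch (a′ * q) q m * P′.ia m                        ≈⟨ ⁻¹-inverse _ (a′qq≉0 m) ⟩
    1#                                                 ≈⟨ ⁻¹-inverse _ (aqq≉0 (suc m)) ⟨
    poch a′ q (suc m) * ia (suc m)                     ≈⟨ *-congʳ (poch-shift a′ q m) ⟨
    (1# - a′) * poch (a′ * q) q m * ia (suc m)
      ≈⟨ solve 3 (λ x P i →
          x :* P :* i
          := P :* (x :* i))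
          refl (1# - a′) (poch (a′ * q) q m) (ia (suc m)) ⟩
    poch (a′ * q) q m * ((1# - a′) * ia (suc m))       ∎)

  iq-step⁻ : ∀ n r → iq n (1 ℕ.+ r ℕ.* 3) ≈ z⁻ r * ((z r - pow q n) * iq n (r ℕ.* 3))
  iq-step⁻ n r = begin
    iq n (1 ℕ.+ r ℕ.* 3)                        ≈⟨ *-identityˡ _ ⟨
    1# * iq n (1 ℕ.+ r ℕ.* 3)                   ≈⟨ *-congʳ (zz⁻≈1 r) ⟨
    z r * z⁻ r * iq n (1 ℕ.+ r ℕ.* 3)           ≈⟨ solve 3 (λ x y i →
        x :* y :* i
        := y :* (x :* i))
        refl (z r) (z⁻ r) (iq n (1 ℕ.+ r ℕ.* 3)) ⟩
    z⁻ r * (z r * iq n (1 ℕ.+ r ℕ.* 3))         ≈⟨ *-congˡ (iq-step n (r ℕ.* 3)) ⟩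
    z⁻ r * ((z r - pow q n) * iq n (r ℕ.* 3))   ∎

  -- λ₀ and λ₁ are the coefficients of α_{3r} and α_{3r+1} relative to C r, and ω the factor of β_n.
  module Paired (α : ℕ → Carrier) (λ₀ λ₁ ω : ℕ → Carrier)
    (α-0 : ∀ r → α (r ℕ.* 3) ≈ C r * λ₀ r)
    (α-1 : ∀ r → α (1 ℕ.+ r ℕ.* 3) ≈ C r * λ₁ r)
    (α-2 : ∀ r → α (2 ℕ.+ r ℕ.* 3) ≈ 0#)
    (combine : ∀ n r →
      λ₀ r * (1# - a * q * (z r * pow q n)) + λ₁ r * (z⁻ r * (z r - pow q n))
      ≈ ω n * (z⁻ r * z⁻ r * (1# - a * q * (z r * z r)))) where

    private
      τ : ℕ → ℕ → Carrier
      τ = baileyTerm α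

    term : ∀ n r → P′.κ * (1# - a′) * (τ n (r ℕ.* 3) + τ n (1 ℕ.+ r ℕ.* 3) + τ n (2 ℕ.+ r ℕ.* 3))
                 ≈ ω n * (P′.g r * P′.I n r)
    term n r = begin
      k * (τ n (r ℕ.* 3) + τ n (1 ℕ.+ r ℕ.* 3) + τ n (2 ℕ.+ r ℕ.* 3))
        ≈⟨ *-congˡ (+-cong (+-cong
             (*-cong (α-0 r) (*-congˡ (trans (P.ia-step m) (*-congʳ (+-congˡ (-‿cong (*-congˡ (pow-+ q (r ℕ.* 3) n))))))))
             (*-cong (α-1 r) (*-congʳ (iq-step⁻ n r)))) (*-congʳ (α-2 r))) ⟩
      k * (C r * λ₀ r * (x * ((1# - a * q * (z r * N)) * y)) + C r * λ₁ r * (z⁻ r * ((z r - N) * x) * y) + 0# * w)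
        ≈⟨ solve 10 (λ k C l m x y α β i w →
            k :* (C :* l :* (x :* (α :* y)) :+ C :* m :* (i :* (β :* x) :* y) :+ :0 :* w)
            := k :* (C :* x :* y) :* (l :* α :+ m :* (i :* β)))
            refl k (C r) (λ₀ r) (λ₁ r) x y (1# - a * q * (z r * N)) (z r - N) (z⁻ r) w ⟩
      k * (C r * x * y) * (λ₀ r * (1# - a * q * (z r * N)) + λ₁ r * (z⁻ r * (z r - N)))
        -- Adding the two terms creates the very-well-poised factor 1 - aq z², which (i) has
        -- explicitly in its α, together with the z⁻² that `C-closed` consumes.
        ≈⟨ *-congˡ (combine n r) ⟩
      k * (C r * x * y) * (ω n * (z⁻ r * z⁻ r * h))
        ≈⟨ solve 8 (λ k a C x y o i h →
            k :* (:1 :- a) :* (C :* x :* y) :* (o :* (i :* i :* h))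
            := o :* (k :* (C :* (i :* i)) :* h :* (x :* ((:1 :- a) :* y))))
            refl P′.κ a′ (C r) x y (ω n) (z⁻ r) h ⟩
      ω n * (P′.κ * (C r * (z⁻ r * z⁻ r)) * h * (x * ((1# - a′) * y)))
        ≈⟨ *-congˡ (*-cong (*-congʳ (C-closed r)) (*-congˡ (sym (ia-shift m)))) ⟩
      ω n * (P′.H r * ((P′.X r - P′.s) * (P′.X r - P′.t)) * h * P′.I n r)
        ≈⟨ solve 5 (λ o H x h i →
            o :* (H :* x :* h :* i)
            := o :* (h :* H :* x :* i))
            refl (ω n) (P′.H r) ((P′.X r - P′.s) * (P′.X r - P′.t)) h (P′.I n r) ⟩
      ω n * (P′.g r * P′.I n r)  ∎
      where
      k = P′.κ * (1# - a′)
      N = pow q n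
      m = r ℕ.* 3 ℕ.+ n
      x = iq n (r ℕ.* 3)
      y = ia (suc m)
      h = 1# - a * q * (z r * z r)
      w = iq n (2 ℕ.+ r ℕ.* 3) * ia (2 ℕ.+ m)

    paired-sum : ∀ m → let n = suc m in
      ω n * (K₀′ a u v q n * P′.B n) ≈ sumTo (λ j → α j ÷ (poch q q (n ∸ j) * poch (a * q) q (n ℕ.+ j))) n
    paired-sum m = *-cancelˡ-≉0 (*-≉0 (P′.κ≉0 u3≉0 v3≉0 aqu3≉0 aqv3≉0) (1-x≉0 aqq≉0)) (begin
      k * (ω n * (K₀′ a u v q n * P′.B n))
        ≈⟨ solve 3 (λ k o x → k :* (o :* x) := o :* (k :* x)) refl k (ω n) (K₀′ a u v q n * P′.B n) ⟩
      ω n * (k * (K₀′ a u v q n * P′.B n))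
        ≈⟨ *-congˡ (P′.S-g-closed m (K₀′den≉0 n)) ⟨
      ω n * P′.S P′.g n n
        ≈⟨ sumTo-* _ _ n ⟨
      sumTo (λ r → ω n * (P′.g r * P′.I n r)) n
        ≈⟨ sumTo-cong n (λ r _ → term n r) ⟨
      sumTo (λ r → k * (τ n (r ℕ.* 3) + τ n (1 ℕ.+ r ℕ.* 3) + τ n (2 ℕ.+ r ℕ.* 3))) n
        ≈⟨ sumTo-* _ _ n ⟩
      k * sumTo (λ r → τ n (r ℕ.* 3) + τ n (1 ℕ.+ r ℕ.* 3) + τ n (2 ℕ.+ r ℕ.* 3)) n
        ≈⟨ *-congˡ (P.bailey-sum α n) ⟨
      k * sumTo (λ j → α j ÷ (poch q q (n ∸ j) * poch (a * q) q (n ℕ.+ j))) n  ∎)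
      where
      n = suc m
      k = P′.κ * (1# - a′)

  private
    -- The exponents of (ii) and (iii) are measured from that of `C`, `T r` + r = (9r² - r)/2: they
    -- differ from it by -6r here, by +1 in `e₂′` and by -3r in `e₃`.
    e₂ : ∀ r → zpow q (ex a u v q (ℤ.- (ℤ.+ 13)) r) ≈ pow q (T r ℕ.+ r) * (z⁻ r * z⁻ r)
    e₂ r = trans (exponent 13 r (T r ℕ.+ r) (r ℕ.* 3 ℕ.+ r ℕ.* 3)
        (≡.trans (≡.cong (ℕ._+ (r ℕ.* 3 ℕ.+ r ℕ.* 3) ℕ.* 2) (≡.sym (T-closed r))) (lemma (T r) r)))
      (*-congˡ (pow-+ q⁻ (r ℕ.* 3) (r ℕ.* 3)))
      where
      lemma : ∀ t r → t ℕ.* 2 ℕ.+ 3 ℕ.* r ℕ.+ (r ℕ.* 3 ℕ.+ r ℕ.* 3) ℕ.* 2 ≡ (t ℕ.+ r) ℕ.* 2 ℕ.+ 13 ℕ.* r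
      lemma = ℕ-Solver.solve-∀

    e₂′ : ∀ r → zpow q (ex a u v q (ℤ.- (ℤ.+ 1)) r ℤ.+ ℤ.+ 1) ≈ q * pow q (T r ℕ.+ r)
    e₂′ r = trans
      (reflexive (≡.cong (λ e → zpow q (e ℤ.+ ℤ.+ 1)) (half-⊖ (9 ℕ.* r ℕ.* r) 1 r (T r ℕ.+ r) 0
        (≡.trans (≡.cong (ℕ._+ 0) (≡.sym (T-closed r))) (lemma (T r) r)))))
      (reflexive (≡.cong (pow q) (ℕ.+-comm (T r ℕ.+ r) 1)))
      where
      lemma : ∀ t r → t ℕ.* 2 ℕ.+ 3 ℕ.* r ℕ.+ 0 ≡ (t ℕ.+ r) ℕ.* 2 ℕ.+ 1 ℕ.* r
      lemma = ℕ-Solver.solve-∀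

    e₃ : ∀ r → zpow q (ex a u v q (ℤ.- (ℤ.+ 7)) r) ≈ pow q (T r ℕ.+ r) * z⁻ r
    e₃ r = exponent 7 r (T r ℕ.+ r) (r ℕ.* 3)
      (≡.trans (≡.cong (ℕ._+ r ℕ.* 3 ℕ.* 2) (≡.sym (T-closed r))) (lemma (T r) r))
      where
      lemma : ∀ t r → t ℕ.* 2 ℕ.+ 3 ℕ.* r ℕ.+ r ℕ.* 3 ℕ.* 2 ≡ (t ℕ.+ r) ℕ.* 2 ℕ.+ 7 ℕ.* r
      lemma = ℕ-Solver.solve-∀

    C-rearrange : ∀ {e} r {w} → e ≈ pow q (T r ℕ.+ r) * w → A a u v q r * e * pow (- a) r ≈ C r * w
    C-rearrange r {w} h = trans (*-congʳ (*-congˡ h))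
      (solve 4 (λ A t w x →
          A :* (t :* w) :* x
          := A :* t :* x :* w)
          refl (A a u v q r) (pow q (T r ℕ.+ r)) w (pow (- a) r))

  α₂-0 : ∀ r → α₂ a u v q (r ℕ.* 3) ≈ C r * (z⁻ r * z⁻ r)
  α₂-0 zero    = sym (trans (*-cong C-zero (*-identityˡ 1#)) (*-identityˡ 1#))
  α₂-0 (suc r) = trans
    (reflexive (at-residue (sel₂ a u v q) (suc r) (s≤s z≤n)))
    (C-rearrange (suc r) (e₂ (suc r)))

  α₂-1 : ∀ r → α₂ a u v q (1 ℕ.+ r ℕ.* 3) ≈ C r * - (a * q)
  α₂-1 r = trans
    (reflexive (at-residue (sel₂ a u v q) r (s≤s (s≤s z≤n))))
    (trans (*-congʳ (*-congˡ (e₂′ r)))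
      (solve 5 (λ A q t a x →
          A :* (q :* t) :* (:- a :* x)
          := A :* t :* x :* :- (a :* q))
          refl (A a u v q r) q (pow q (T r ℕ.+ r)) a (pow (- a) r)))

  α₂-2 : ∀ r → α₂ a u v q (2 ℕ.+ r ℕ.* 3) ≈ 0#
  α₂-2 r = reflexive (at-residue (sel₂ a u v q) r (s≤s (s≤s (s≤s z≤n))))

  α₃-0 : ∀ r → α₃ a u v q (r ℕ.* 3) ≈ C r * z⁻ r
  α₃-0 zero    = sym (trans (*-congʳ C-zero) (*-identityˡ 1#))
  α₃-0 (suc r) = trans
    (reflexive (at-residue (sel₃ a u v q) (suc r) (s≤s z≤n)))
    (C-rearrange (suc r) (e₃ (suc r)))

  α₃-1 : ∀ r → α₃ a u v q (1 ℕ.+ r ℕ.* 3) ≈ C r * - z⁻ r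
  α₃-1 r = trans
    (reflexive (at-residue (sel₃ a u v q) r (s≤s (s≤s z≤n))))
    (trans (-‿cong (C-rearrange r (e₃ r))) (solve 2 (λ C w →
        :- (C :* w)
        := C :* :- w)
        refl (C r) (z⁻ r)))

  α₃-2 : ∀ r → α₃ a u v q (2 ℕ.+ r ℕ.* 3) ≈ 0#
  α₃-2 r = reflexive (at-residue (sel₃ a u v q) r (s≤s (s≤s (s≤s z≤n))))

  -- The terms in N cancel, and z⁻² - aq is left, free of n.
  combine₂ : ∀ n r → let N = pow q n in
    z⁻ r * z⁻ r * (1# - a * q * (z r * N)) + - (a * q) * (z⁻ r * (z r - N))
    ≈ 1# * (z⁻ r * z⁻ r * (1# - a * q * (z r * z r)))
  combine₂ n r = modulo (a * q * (z r * z⁻ r) - a * q * pow q n * z⁻ r) (zz⁻≈1 r)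
    (solve 5 (λ i Z a q N →
        i :* i :* (:1 :- a :* q :* (Z :* N)) :+ :- (a :* q) :* (i :* (Z :- N))
        := :1 :* (i :* i :* (:1 :- a :* q :* (Z :* Z))) :+ (a :* q :* (Z :* i) :- a :* q :* N :* i)
           :* (Z :* i :- :1))
        refl (z⁻ r) (z r) a q (pow q n))

  -- Here the terms without N cancel instead; the surviving factor N is the qⁿ in `β₃`.
  combine₃ : ∀ n r → let N = pow q n in
    z⁻ r * (1# - a * q * (z r * N)) + - z⁻ r * (z⁻ r * (z r - N))
    ≈ N * (z⁻ r * z⁻ r * (1# - a * q * (z r * z r)))
  combine₃ n r = modulo (a * q * pow q n * z r * z⁻ r - z⁻ r) (zz⁻≈1 r)
    (solve 5 (λ i Z a q N →
        i :* (:1 :- a :* q :* (Z :* N)) :+ :- i :* (i :* (Z :- N))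
        := N :* (i :* i :* (:1 :- a :* q :* (Z :* Z))) :+ (a :* q :* N :* Z :* i :- i) :* (Z :* i :-
           :1))
        refl (z⁻ r) (z r) a q (pow q n))

  module Pair₂ = Paired (α₂ a u v q) (λ r → z⁻ r * z⁻ r) (λ _ → - (a * q)) (λ _ → 1#) α₂-0 α₂-1 α₂-2 combine₂
  module Pair₃ = Paired (α₃ a u v q) z⁻ (λ r → - z⁻ r) (pow q) α₃-0 α₃-1 α₃-2 combine₃

  pair₂ : BaileyPair a q (α₂ a u v q) (β₂ a u v q)
  pair₂ = refl , λ
    { zero    → 1≈1÷[1*1]
    ; (suc m) → trans (sym (*-identityˡ _)) (Pair₂.paired-sum m) }

  pair₃ : BaileyPair a q (α₃ a u v q) (β₃ a u v q)
  pair₃ = refl , λ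
    { zero      → 1≈1÷[1*1]
    ; n@(suc m) → trans
        (solve 4 (λ k P N i →
            k :* (P :* N :* i)
            := N :* (k :* (P :* i)))
            refl (K₀′ a u v q n) (poch (a * q) p n) (pow q n)
            ((poch (a * q) q (2 ℕ.* n) * poch q q n) ⁻¹))
        (Pair₃.paired-sum m) }

theorem2p3 : ∀ {c ℓ} (F : Field c ℓ) (a u v q : Field.Carrier F) →
    FieldDefs.Generic F a u v q →
    FieldDefs.BaileyPair F a q (FieldDefs.α₁ F a u v q) (FieldDefs.β₁ F a u v q)
    × FieldDefs.BaileyPair F a q (FieldDefs.α₂ F a u v q) (FieldDefs.β₂ F a u v q)
    × FieldDefs.BaileyPair F a q (FieldDefs.α₃ F a u v q) (FieldDefs.β₃ F a u v q)
theorem2p3 F a u v q generic = pair₁ , pair₂ , pair₃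
  where
  open BaileyPairs F a u v q generic
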